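{- Let $t\geq 6$ be an integer and suppose that every $PG(t-2,2)$-free matroid $M'$ with $|M'|>(1-3\cdot 2^{ -(t-1)})2^{r(M')}$ satisfies $\chi(M')\in\{t-2,t-1\}$. Then there is no $PG(t-1,2)$-free matroid $M$ with $|M|>(1-3\cdot 2^{ -t})2^{r(M)}$ and $\chi(M)>t$.
   Context: A matroid $M$ means a simple binary matroid, represented by an integer $r(M)\geq 0$ (its rank) and a set $E(M)\subseteq \mathbb{F}_2^{r(M)}\setminus\{0\}$ that spans $\mathbb{F}_2^{r(M)}$; $|M|:=|E(M)|$. The critical number $\chi(M)$ is the smallest $k$ such that some subspace of $\mathbb{F}_2^{r(M)}$ of codimension $k$ is disjoint from $E(M)$. A matroid $M$ contains a matroid $N$ if there is an injective linear map $\iota:\mathbb{F}_2^{r(N)}\to\mathbb{F}_2^{r(M)}$ with $\iota(E(N))\subseteq E(M)$; $M$ is $N$-free if it does not contain $N$. The projective geometry $PG(s-1,2)$ is the matroid of rank $s$ with edge set $\mathbb{F}_2^s\setminus\{0\}$. -}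

module Defs where

open import Data.Bool using (Bool; true; false; _xor_)
open import Data.Nat using (ℕ; zero; suc; _+_; _*_; _∸_; _^_; _<_; _≤_)
open import Data.Vec using (Vec; []; _∷_; replicate; zipWith; foldr)
open import Data.List using (List; []; _∷_; _++_; map; length; filterᵇ)
open import Data.List.Relation.Unary.All using (All; []; _∷_)
open import Data.Product using (Σ; ∃; _×_; _,_)
open import Data.Empty using (⊥)
open import Relation.Nullary using (¬_)
open import Relation.Binary.PropositionalEquality using (_≡_; _≢_; refl; cong; cong₂; sym)
open import Data.Vec.Relation.Unary.All renaming (All to VAll) using ()
open import Data.Bool using (_∨_)
open import Data.Bool.Properties using (xor-identityʳ)

F2^ : ℕ → Set
F2^ n = Vec Bool n

0v : ∀ {n} → F2^ n
0v = replicate _ false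

_⊕_ : ∀ {n} → F2^ n → F2^ n → F2^ n
_⊕_ = zipWith _xor_

sumV : ∀ {n} → List (F2^ n) → F2^ n
sumV [] = 0v
sumV (x ∷ xs) = x ⊕ sumV xs

dot : ∀ {n} → F2^ n → F2^ n → Bool
dot [] [] = false
dot (true ∷ xs) (true ∷ ys) = true xor dot xs ys
dot (_ ∷ xs) (_ ∷ ys) = dot xs ys

allVecs : (n : ℕ) → List (F2^ n)
allVecs zero = [] ∷ []
allVecs (suc n) = map (false ∷_) (allVecs n) ++ map (true ∷_) (allVecs n)

-- A simple binary matroid: rank r, edge set E ⊆ F₂^r \ {0} (given by its
-- characteristic function) spanning F₂^r.
record Matroid : Set where
  field
    rank  : ℕ
    E     : F2^ rank → Bool
    simple : E 0v ≡ false
    spans : ∀ (v : F2^ rank) →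
            ∃ λ (xs : List (F2^ rank)) → All (λ e → E e ≡ true) xs × sumV xs ≡ v
open Matroid public

size : Matroid → ℕ
size M = length (filterᵇ (E M) (allVecs (rank M)))

lincomb : ∀ {n k} → Vec Bool k → Vec (F2^ n) k → F2^ n
lincomb [] [] = 0v
lincomb (true ∷ as) (c ∷ cs) = c ⊕ lincomb as cs
lincomb (false ∷ as) (c ∷ cs) = lincomb as cs

LinIndep : ∀ {n k} → Vec (F2^ n) k → Set
LinIndep {n} {k} cs = ∀ (a : Vec Bool k) → a ≢ 0v → lincomb a cs ≢ 0v

InKernel : ∀ {n k} → Vec (F2^ n) k → F2^ n → Set
InKernel cs x = VAll (λ c → dot c x ≡ false) cs

-- some subspace of F₂^r of codimension k (kernel of k linearly independent
-- functionals) is disjoint from E(M)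
HasDisjointCodim : Matroid → ℕ → Set
HasDisjointCodim M k =
  ∃ λ (cs : Vec (F2^ (rank M)) k) → LinIndep cs ×
    (∀ (x : F2^ (rank M)) → InKernel cs x → E M x ≡ false)

CriticalNumber : Matroid → ℕ → Set
CriticalNumber M k = HasDisjointCodim M k × (∀ j → j < k → ¬ HasDisjointCodim M j)

Contains : Matroid → Matroid → Set
Contains M N =
  ∃ λ (ι : F2^ (rank N) → F2^ (rank M)) →
    (∀ x y → ι (x ⊕ y) ≡ ι x ⊕ ι y) ×
    (∀ x y → ι x ≡ ι y → x ≡ y) ×
    (∀ x → E N x ≡ true → E M (ι x) ≡ true)

nz : ∀ {n} → F2^ n → Bool
nz [] = false
nz (b ∷ v) = b ∨ nz v

nz-0v : ∀ n → nz (0v {n}) ≡ false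
nz-0v zero = refl
nz-0v (suc n) = nz-0v n

⊕-0v : ∀ {n} (v : F2^ n) → v ⊕ 0v ≡ v
⊕-0v [] = refl
⊕-0v (b ∷ v) = cong₂ _∷_ (xor-identityʳ b) (⊕-0v v)

nz-false : ∀ {n} (v : F2^ n) → nz v ≡ false → v ≡ 0v
nz-false [] _ = refl
nz-false (false ∷ v) p = cong (false ∷_) (nz-false v p)
nz-false (true ∷ v) ()

PG-spans : ∀ s (v : F2^ s) →
  ∃ λ (xs : List (F2^ s)) → All (λ e → nz e ≡ true) xs × sumV xs ≡ v
PG-spans s v with nz v in eq
... | true = (v ∷ []) , (eq ∷ []) , ⊕-0v v
... | false = [] , [] , sym (nz-false v eq)

-- PGr s = PG(s-1,2): rank s, all nonzero vectors of F₂^s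
PGr : ℕ → Matroid
PGr s = record { rank = s ; E = nz ; simple = nz-0v s ; spans = PG-spans s }

Free : Matroid → Matroid → Set
Free N M = ¬ Contains M N

{-# OPTIONS --safe #-}
module Submission where

-- Let B be the complement of E(M) in V = F₂^r, and Q = 2^(r-t), so that |B| < 3Q. Suppose that B contains
-- no subspace of codimension at most t.
--
-- (1) Every hyperplane misses at least Q points of B. Otherwise the hypothesis for t - 1, applied to the
-- preimage of E(M) under a projection onto the hyperplane, gives a subspace of codimension t inside B.
-- Averaging over a group Φ of functionals yields |Φ| |B ∩ Φ^⊥| < (|Φ| + 2) Q.
--
-- (2) For e in E(M) the set {x : x, x + e ∈ E(M)} contains no PG(t-2,2), since adding e would give a PG(t-1,2)
-- in M. The hypothesis and (1) produce a subspace W ∋ e with |W| = 2Q in which B meets every coset of {0, e},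
-- so that |B ∩ W| ≥ Q.
--
-- (3) For two such subspaces, (1) with Φ = W^⊥ ∩ W'^⊥ shows that |B ∩ W ∩ W'| is at most Q/6 or exceeds 9Q/11.
-- In the second case W ∩ W' contains a point x outside B. If moreover e'' ∉ B and x + e'' ∉ B, then the subspace
-- W'' of e'' avoids x, and |B ∩ W ∩ W''| > 9Q/11 would make B ∩ W too large for (1).
-- So W'' meets W in at most Q/6 points of B.
--
-- (4) Since t ≥ 6, centres avoiding these obstructions can be chosen four times, and four subsets of B of size
-- at least Q with pairwise intersections at most Q/6 force |B| ≥ 3Q.

open import Defs
open import Algebra.Bundles using (CommutativeRing)
open import Data.Bool using (Bool; true; false; not; _∧_; _∨_; _xor_; if_then_else_)
open import Data.Bool.Properties
  using (∧-comm; ∧-zeroʳ; ∧-conicalˡ; ∧-conicalʳ; ∨-conicalˡ; ∨-conicalʳ; ∧-distribˡ-xor; xor-assoc; xor-comm;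
         xor-same; xor-identityˡ; xor-identityʳ; xor-∧-commutativeRing; ∨-∧-booleanAlgebra; not-injective; ¬-not)
open import Algebra.Lattice.Properties.BooleanAlgebra ∨-∧-booleanAlgebra using (deMorgan₁)
open import Algebra.Properties.CommutativeSemigroup
  (CommutativeRing.+-commutativeSemigroup xor-∧-commutativeRing) using () renaming (interchange to xor-interchange)
open import Data.Empty using (⊥; ⊥-elim)
open import Data.List as List using (List; []; _∷_; length; filterᵇ)
open import Data.List.Relation.Unary.All using (All; []; _∷_)
open import Data.List.Relation.Unary.AllPairs using (AllPairs; []; _∷_)
open import Data.Nat using (ℕ; zero; suc; _+_; _*_; _∸_; _^_; _≤_; _<_; z≤n; s≤s; _≤?_; _<?_; NonZero; >-nonZero)
open import Data.Nat.Induction using (<-rec)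
open import Data.Nat.Properties
open import Algebra.Properties.CommutativeSemigroup +-commutativeSemigroup
  using () renaming (interchange to +-interchange)
open import Data.Nat.Tactic.RingSolver using (solve-∀)
open import Data.Product using (Σ; ∃; _×_; _,_; proj₁; proj₂)
open import Data.Sum using (_⊎_; inj₁; inj₂; [_,_]′)
open import Data.Vec using (Vec; []; _∷_; map) renaming (_++_ to _++ᵥ_)
open import Data.Vec.Properties using (zipWith-assoc; zipWith-comm; zipWith-identityˡ)
open import Data.Vec.Relation.Unary.All using ([]; _∷_)
open import Function using (_∘_)
open import Relation.Binary.PropositionalEquality
open import Relation.Nullary using (¬_; yes; no; contradiction)
open import Relation.Nullary.Decidable using (from-yes)

-- Sums and counting over F₂ⁿ

∑ : ∀ {n} → (F2^ n → ℕ) → ℕ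
∑ {zero}  f = f []
∑ {suc n} f = ∑ (f ∘ (false ∷_)) + ∑ (f ∘ (true ∷_))

⟦_⟧ : Bool → ℕ
⟦ false ⟧ = 0
⟦ true ⟧  = 1

# : ∀ {n} → (F2^ n → Bool) → ℕ
# P = ∑ (λ x → ⟦ P x ⟧)

infixr 6 _∩_
_∩_ : ∀ {n} → (F2^ n → Bool) → (F2^ n → Bool) → F2^ n → Bool
(P ∩ P′) x = P x ∧ P′ x

∑-cong : ∀ {n} {f g : F2^ n → ℕ} → (∀ x → f x ≡ g x) → ∑ f ≡ ∑ g
∑-cong {zero}  h = h []
∑-cong {suc n} h = cong₂ _+_ (∑-cong (h ∘ (false ∷_))) (∑-cong (h ∘ (true ∷_)))

∑-mono : ∀ {n} {f g : F2^ n → ℕ} → (∀ x → f x ≤ g x) → ∑ f ≤ ∑ g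
∑-mono {zero}  h = h []
∑-mono {suc n} h = +-mono-≤ (∑-mono (h ∘ (false ∷_))) (∑-mono (h ∘ (true ∷_)))

∑-+ : ∀ {n} (f g : F2^ n → ℕ) → ∑ (λ x → f x + g x) ≡ ∑ f + ∑ g
∑-+ {zero}  f g = refl
∑-+ {suc n} f g =
  trans (cong₂ _+_ (∑-+ (f ∘ (false ∷_)) (g ∘ (false ∷_))) (∑-+ (f ∘ (true ∷_)) (g ∘ (true ∷_))))
        (+-interchange (∑ (f ∘ (false ∷_))) _ _ _)

∑-* : ∀ {n} c (f : F2^ n → ℕ) → ∑ (λ x → c * f x) ≡ c * ∑ f
∑-* {zero}  c f = refl
∑-* {suc n} c f =
  trans (cong₂ _+_ (∑-* c (f ∘ (false ∷_))) (∑-* c (f ∘ (true ∷_)))) (sym (*-distribˡ-+ c _ _))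

∑-*ʳ : ∀ {n} (f : F2^ n → ℕ) c → ∑ (λ x → f x * c) ≡ ∑ f * c
∑-*ʳ f c = trans (∑-cong (λ x → *-comm (f x) c)) (trans (∑-* c f) (*-comm c _))

∑-const : ∀ {n} c → ∑ {n} (λ _ → c) ≡ 2 ^ n * c
∑-const {zero}  c = sym (*-identityˡ c)
∑-const {suc n} c =
  trans (cong₂ _+_ (∑-const {n} c) (∑-const {n} c)) (double (2 ^ n) c)
  where
  double : ∀ a c → a * c + a * c ≡ 2 * a * c
  double = solve-∀

∑-swap : ∀ {m n} (f : F2^ m → F2^ n → ℕ) → ∑ (λ x → ∑ (f x)) ≡ ∑ (λ y → ∑ (λ x → f x y))
∑-swap {zero}  f = refl
∑-swap {suc m} f =
  trans (cong₂ _+_ (∑-swap (f ∘ (false ∷_))) (∑-swap (f ∘ (true ∷_)))) (sym (∑-+ (λ y → ∑ (λ x → f (false ∷ x) y)) _))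

∑-shift : ∀ {n} (e : F2^ n) (f : F2^ n → ℕ) → ∑ (λ x → f (x ⊕ e)) ≡ ∑ f
∑-shift []          f = refl
∑-shift (false ∷ e) f = cong₂ _+_ (∑-shift e (f ∘ (false ∷_))) (∑-shift e (f ∘ (true ∷_)))
∑-shift (true ∷ e)  f =
  trans (cong₂ _+_ (∑-shift e (f ∘ (true ∷_))) (∑-shift e (f ∘ (false ∷_)))) (+-comm (∑ (f ∘ (true ∷_))) _)

∑-0 : ∀ {n} {f : F2^ n → ℕ} → (∀ x → f x ≡ 0) → ∑ f ≡ 0
∑-0 {n} h = trans (∑-cong h) (trans (∑-const {n} 0) (*-zeroʳ (2 ^ n)))

∑-1 : ∀ {n} → ∑ {n} (λ _ → 1) ≡ 2 ^ n
∑-1 {n} = trans (∑-const {n} 1) (*-identityʳ _)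

⟦∧⟧ : ∀ a b → ⟦ a ∧ b ⟧ ≡ ⟦ a ⟧ * ⟦ b ⟧
⟦∧⟧ false b = refl
⟦∧⟧ true  b = sym (+-identityʳ _)

⟦not⟧ : ∀ a → ⟦ a ⟧ + ⟦ not a ⟧ ≡ 1
⟦not⟧ false = refl
⟦not⟧ true  = refl

⟦⟧-split : ∀ a b → ⟦ a ∧ b ⟧ + ⟦ a ∧ not b ⟧ ≡ ⟦ a ⟧
⟦⟧-split false b     = refl
⟦⟧-split true  false = refl
⟦⟧-split true  true  = refl

⟦⟧-mono : ∀ {a b} → (a ≡ true → b ≡ true) → ⟦ a ⟧ ≤ ⟦ b ⟧
⟦⟧-mono {false} h = z≤n
⟦⟧-mono {true}  h rewrite h refl = ≤-refl

#-mono : ∀ {n} {P P′ : F2^ n → Bool} → (∀ x → P x ≡ true → P′ x ≡ true) → # P ≤ # P′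
#-mono h = ∑-mono (λ x → ⟦⟧-mono (h x))

#-cong : ∀ {n} {P P′ : F2^ n → Bool} → (∀ x → P x ≡ P′ x) → # P ≡ # P′
#-cong h = ∑-cong (λ x → cong ⟦_⟧ (h x))

#-complement : ∀ {n} (P : F2^ n → Bool) → # P + # (not ∘ P) ≡ 2 ^ n
#-complement {n} P = trans (sym (∑-+ (λ x → ⟦ P x ⟧) _)) (trans (∑-cong (λ x → ⟦not⟧ (P x))) (∑-1 {n}))

#-split : ∀ {n} (P P′ : F2^ n → Bool) → # (P ∩ P′) + # (P ∩ (not ∘ P′)) ≡ # P
#-split P P′ = trans (sym (∑-+ (λ x → ⟦ (P ∩ P′) x ⟧) _)) (∑-cong (λ x → ⟦⟧-split (P x) (P′ x)))

-- Exhaustion makes quantifiers over points decidable. Double negations enter only later, through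
-- flats and least codimensions.
search : ∀ {n} (P : F2^ n → Bool) → (∃ λ x → P x ≡ true) ⊎ (∀ x → P x ≡ false)
search {zero} P with P [] in eq
... | true  = inj₁ ([] , eq)
... | false = inj₂ (λ { [] → eq })
search {suc n} P with search (P ∘ (false ∷_)) | search (P ∘ (true ∷_))
... | inj₁ (x , p) | _            = inj₁ (false ∷ x , p)
... | inj₂ _       | inj₁ (x , p) = inj₁ (true ∷ x , p)
... | inj₂ p       | inj₂ q       = inj₂ (λ { (false ∷ x) → p x ; (true ∷ x) → q x })

#-witness : ∀ {n} (P : F2^ n → Bool) x → P x ≡ true → 1 ≤ # P
#-witness {zero}  P []          p rewrite p = ≤-refl
#-witness {suc n} P (false ∷ x) p = ≤-trans (#-witness (P ∘ (false ∷_)) x p) (m≤m+n _ _)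
#-witness {suc n} P (true ∷ x)  p = ≤-trans (#-witness (P ∘ (true ∷_)) x p) (m≤n+m _ _)

#<⇒avoid : ∀ {n} (P : F2^ n → Bool) → # P < 2 ^ n → ∃ λ x → P x ≡ false
#<⇒avoid {n} P small with search (not ∘ P)
... | inj₁ (x , p) = x , not-injective p
... | inj₂ none    = contradiction small (≤⇒≯ (≤-reflexive (begin
  2 ^ n               ≡⟨ #-complement P ⟨
  # P + # (not ∘ P)   ≡⟨ cong (# P +_) (∑-0 (λ x → cong ⟦_⟧ (none x))) ⟩
  # P + 0             ≡⟨ +-identityʳ _ ⟩
  # P                 ∎)))
  where open ≡-Reasoning

filter-map-length : ∀ {A B : Set} (P : B → Bool) (f : A → B) xs →
  length (filterᵇ P (List.map f xs)) ≡ length (filterᵇ (P ∘ f) xs)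
filter-map-length P f []       = refl
filter-map-length P f (x ∷ xs) with P (f x)
... | true  = cong suc (filter-map-length P f xs)
... | false = filter-map-length P f xs

filter-++-length : ∀ {A : Set} (P : A → Bool) xs ys →
  length (filterᵇ P (xs List.++ ys)) ≡ length (filterᵇ P xs) + length (filterᵇ P ys)
filter-++-length P []       ys = refl
filter-++-length P (x ∷ xs) ys with P x
... | true  = cong suc (filter-++-length P xs ys)
... | false = filter-++-length P xs ys

length-filter-allVecs : ∀ n (P : F2^ n → Bool) → length (filterᵇ P (allVecs n)) ≡ # P
length-filter-allVecs zero P with P []
... | true  = refl
... | false = refl
length-filter-allVecs (suc n) P = begin
  length (filterᵇ P (List.map (false ∷_) (allVecs n) List.++ List.map (true ∷_) (allVecs n)))
    ≡⟨ filter-++-length P (List.map (false ∷_) (allVecs n)) _ ⟩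
  length (filterᵇ P (List.map (false ∷_) (allVecs n))) + length (filterᵇ P (List.map (true ∷_) (allVecs n)))
    ≡⟨ cong₂ _+_ (filter-map-length P (false ∷_) (allVecs n)) (filter-map-length P (true ∷_) (allVecs n)) ⟩
  length (filterᵇ (P ∘ (false ∷_)) (allVecs n)) + length (filterᵇ (P ∘ (true ∷_)) (allVecs n))
    ≡⟨ cong₂ _+_ (length-filter-allVecs n (P ∘ (false ∷_))) (length-filter-allVecs n (P ∘ (true ∷_))) ⟩
  # P ∎
  where open ≡-Reasoning

-- Linear algebra over F₂

⊕-assoc : ∀ {n} (x y z : F2^ n) → (x ⊕ y) ⊕ z ≡ x ⊕ (y ⊕ z)
⊕-assoc = zipWith-assoc xor-assoc

⊕-comm : ∀ {n} (x y : F2^ n) → x ⊕ y ≡ y ⊕ x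
⊕-comm = zipWith-comm xor-comm

⊕-identityˡ : ∀ {n} (x : F2^ n) → 0v ⊕ x ≡ x
⊕-identityˡ = zipWith-identityˡ xor-identityˡ

⊕-self : ∀ {n} (x : F2^ n) → x ⊕ x ≡ 0v
⊕-self []      = refl
⊕-self (b ∷ x) = cong₂ _∷_ (xor-same b) (⊕-self x)

⊕-cancelʳ : ∀ {n} (x y : F2^ n) → (x ⊕ y) ⊕ y ≡ x
⊕-cancelʳ x y = trans (⊕-assoc x y y) (trans (cong (x ⊕_) (⊕-self y)) (⊕-0v x))

⊕-cancelˡ : ∀ {n} (x y : F2^ n) → x ⊕ (x ⊕ y) ≡ y
⊕-cancelˡ x y = trans (sym (⊕-assoc x x y)) (trans (cong (_⊕ y) (⊕-self x)) (⊕-identityˡ y))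

⊕-interchange : ∀ {n} (a b c d : F2^ n) → (a ⊕ b) ⊕ (c ⊕ d) ≡ (a ⊕ c) ⊕ (b ⊕ d)
⊕-interchange []      []      []      []      = refl
⊕-interchange (a ∷ x) (b ∷ y) (c ∷ z) (d ∷ w) = cong₂ _∷_ (xor-interchange a b c d) (⊕-interchange x y z w)

dot-comm : ∀ {n} (x y : F2^ n) → dot x y ≡ dot y x
dot-comm []          []          = refl
dot-comm (true ∷ x)  (true ∷ y)  = cong not (dot-comm x y)
dot-comm (true ∷ x)  (false ∷ y) = dot-comm x y
dot-comm (false ∷ x) (true ∷ y)  = dot-comm x y
dot-comm (false ∷ x) (false ∷ y) = dot-comm x y

dot-∷ : ∀ {n} a b (x y : F2^ n) → dot (a ∷ x) (b ∷ y) ≡ (a ∧ b) xor dot x y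
dot-∷ true  true  x y = refl
dot-∷ true  false x y = refl
dot-∷ false b     x y = refl

dot-⊕ʳ : ∀ {n} (x y z : F2^ n) → dot x (y ⊕ z) ≡ dot x y xor dot x z
dot-⊕ʳ []      []      []      = refl
dot-⊕ʳ (a ∷ x) (b ∷ y) (c ∷ z)
  rewrite dot-∷ a (b xor c) x (y ⊕ z) | dot-∷ a b x y | dot-∷ a c x z
        | ∧-distribˡ-xor a b c | dot-⊕ʳ x y z
  = xor-interchange (a ∧ b) (a ∧ c) (dot x y) (dot x z)

dot-⊕ˡ : ∀ {n} (x y z : F2^ n) → dot (x ⊕ y) z ≡ dot x z xor dot y z
dot-⊕ˡ x y z = trans (dot-comm _ z) (trans (dot-⊕ʳ z x y) (cong₂ _xor_ (dot-comm z x) (dot-comm z y)))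

dot-0ˡ : ∀ {n} (x : F2^ n) → dot 0v x ≡ false
dot-0ˡ []      = refl
dot-0ˡ (b ∷ x) = dot-0ˡ x

dot-0ʳ : ∀ {n} (x : F2^ n) → dot x 0v ≡ false
dot-0ʳ x = trans (dot-comm x 0v) (dot-0ˡ x)

ker : ∀ {n k} → Vec (F2^ n) k → F2^ n → Bool
ker []       x = true
ker (c ∷ cs) x = not (dot c x) ∧ ker cs x

ker⇒InKernel : ∀ {n k} (cs : Vec (F2^ n) k) x → ker cs x ≡ true → InKernel cs x
ker⇒InKernel []       x p = []
ker⇒InKernel (c ∷ cs) x p = not-injective (∧-conicalˡ _ _ p) ∷ ker⇒InKernel cs x (∧-conicalʳ (not (dot c x)) _ p)

InKernel⇒ker : ∀ {n k} (cs : Vec (F2^ n) k) x → InKernel cs x → ker cs x ≡ true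
InKernel⇒ker []       x []       = refl
InKernel⇒ker (c ∷ cs) x (p ∷ ps) = cong₂ (λ a b → not a ∧ b) p (InKernel⇒ker cs x ps)

ker-++ : ∀ {n k l} (cs : Vec (F2^ n) k) (ds : Vec (F2^ n) l) x → ker (cs ++ᵥ ds) x ≡ ker cs x ∧ ker ds x
ker-++ []       ds x = refl
ker-++ (c ∷ cs) ds x with dot c x
... | true  = refl
... | false = ker-++ cs ds x

dot-lincomb : ∀ {n k} (a : Vec Bool k) (cs : Vec (F2^ n) k) x → ker cs x ≡ true → dot (lincomb a cs) x ≡ false
dot-lincomb []          []       x p = dot-0ˡ x
dot-lincomb (true ∷ a)  (c ∷ cs) x p =
  trans (dot-⊕ˡ c _ x) (cong₂ _xor_ (not-injective (∧-conicalˡ (not (dot c x)) _ p)) (dot-lincomb a cs x (∧-conicalʳ (not (dot c x)) _ p)))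
dot-lincomb (false ∷ a) (c ∷ cs) x p = dot-lincomb a cs x (∧-conicalʳ (not (dot c x)) _ p)

basis : ∀ n → Vec (F2^ n) n
basis zero    = []
basis (suc n) = (true ∷ 0v) ∷ map (false ∷_) (basis n)

ker-map-false : ∀ {n k} (cs : Vec (F2^ n) k) b x → ker (map (false ∷_) cs) (b ∷ x) ≡ ker cs x
ker-map-false []       b x = refl
ker-map-false (c ∷ cs) b x = cong (not (dot c x) ∧_) (ker-map-false cs b x)

ker-basis : ∀ {n} (x : F2^ n) → ker (basis n) x ≡ true → x ≡ 0v
ker-basis []          p = refl
ker-basis {suc n} (false ∷ x) p =
  cong (false ∷_) (ker-basis x (trans (sym (ker-map-false (basis n) false x)) (∧-conicalʳ (not (dot 0v x)) _ p)))
ker-basis {suc n} (true ∷ x)  p with trans (sym (∧-conicalˡ (not (not (dot 0v x))) _ p)) (cong (not ∘ not) (dot-0ˡ x))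
... | ()

nondegenerate : ∀ {n} (x : F2^ n) → (∀ c → dot c x ≡ false) → x ≡ 0v
nondegenerate {n} x h = ker-basis x (all-ker (basis n))
  where
  all-ker : ∀ {k} (cs : Vec (F2^ n) k) → ker cs x ≡ true
  all-ker []       = refl
  all-ker (c ∷ cs) = cong₂ (λ a b → not a ∧ b) (h c) (all-ker cs)

record IsSubspace {n} (P : F2^ n → Bool) : Set where
  field
    0∈       : P 0v ≡ true
    ⊕-closed : ∀ x y → P x ≡ true → P y ≡ true → P (x ⊕ y) ≡ true
open IsSubspace public

∧-intro : ∀ {a b} → a ≡ true → b ≡ true → a ∧ b ≡ true
∧-intro refl refl = refl

true≢false : ∀ {a} → a ≡ true → a ≡ false → ⊥
true≢false refl ()

∩-isSubspace : ∀ {n} {P P′ : F2^ n → Bool} → IsSubspace P → IsSubspace P′ → IsSubspace (P ∩ P′)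
∩-isSubspace p p′ .0∈ = ∧-intro (0∈ p) (0∈ p′)
∩-isSubspace {P = P} p p′ .⊕-closed x y px py =
  ∧-intro (⊕-closed p x y (∧-conicalˡ _ _ px) (∧-conicalˡ _ _ py))
          (⊕-closed p′ x y (∧-conicalʳ (P x) _ px) (∧-conicalʳ (P y) _ py))

⊥-isSubspace : ∀ {n} (c : F2^ n) → IsSubspace (λ x → not (dot c x))
⊥-isSubspace c .0∈ = cong not (dot-0ʳ c)
⊥-isSubspace c .⊕-closed x y px py =
  cong not (trans (dot-⊕ʳ c x y) (cong₂ _xor_ (not-injective px) (not-injective py)))

ker-isSubspace : ∀ {n k} (cs : Vec (F2^ n) k) → IsSubspace (ker cs)
ker-isSubspace []       = record { 0∈ = refl ; ⊕-closed = λ _ _ _ _ → refl }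
ker-isSubspace (c ∷ cs) = ∩-isSubspace (⊥-isSubspace c) (ker-isSubspace cs)

full-isSubspace : ∀ {n} → IsSubspace {n} (λ _ → true)
full-isSubspace = record { 0∈ = refl ; ⊕-closed = λ _ _ _ _ → refl }

-- Boolean-valued through `search`, so that annihilators can be counted like any other set.
perp : ∀ {n} → (F2^ n → Bool) → F2^ n → Bool
perp P y with search (λ x → P x ∧ dot x y)
... | inj₁ _ = false
... | inj₂ _ = true

perp-elim : ∀ {n} (P : F2^ n → Bool) x y → perp P y ≡ true → P x ≡ true → dot x y ≡ false
perp-elim P x y p px with search (λ x → P x ∧ dot x y)
... | inj₁ _ = contradiction p λ ()
... | inj₂ h = trans (cong (_∧ dot x y) (sym px)) (h x)

perp-intro : ∀ {n} (P : F2^ n → Bool) y → (∀ x → P x ≡ true → dot x y ≡ false) → perp P y ≡ true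
perp-intro P y h with search (λ x → P x ∧ dot x y)
... | inj₁ (x , p) = ⊥-elim (true≢false (∧-conicalʳ (P x) _ p) (h x (∧-conicalˡ _ _ p)))
... | inj₂ _       = refl

perp-witness : ∀ {n} (P : F2^ n → Bool) y → perp P y ≡ false → ∃ λ x → P x ≡ true × dot x y ≡ true
perp-witness P y p with search (λ x → P x ∧ dot x y)
... | inj₁ (x , q) = x , ∧-conicalˡ _ _ q , ∧-conicalʳ (P x) _ q
... | inj₂ _       = contradiction p λ ()

perp-isSubspace : ∀ {n} (P : F2^ n → Bool) → IsSubspace (perp P)
perp-isSubspace P .0∈ = perp-intro P 0v (λ x _ → dot-0ʳ x)
perp-isSubspace P .⊕-closed y z py pz = perp-intro P _ λ x px →
  trans (dot-⊕ʳ x y z) (cong₂ _xor_ (perp-elim P x y py px) (perp-elim P x z pz px))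

⊆-perp-perp : ∀ {n} (P : F2^ n → Bool) x → P x ≡ true → perp (perp P) x ≡ true
⊆-perp-perp P x px = perp-intro (perp P) x λ y py → trans (dot-comm y x) (perp-elim P x y py px)

-- Translation by `x` carries `P ∩ P′` injectively into the part of `P` outside `P′`.
proper-half : ∀ {n} {P P′ : F2^ n → Bool} → IsSubspace P → IsSubspace P′ →
  ∀ x → P x ≡ true → P′ x ≡ false → 2 * # (P ∩ P′) ≤ # P
proper-half {P = P} {P′} p p′ x px p′x = begin
  2 * # (P ∩ P′)                           ≡⟨ cong (# (P ∩ P′) +_) (+-identityʳ _) ⟩
  # (P ∩ P′) + # (P ∩ P′)                  ≡⟨ cong (# (P ∩ P′) +_) (∑-shift x _) ⟨
  # (P ∩ P′) + # (λ z → (P ∩ P′) (z ⊕ x))  ≤⟨ +-monoʳ-≤ (# (P ∩ P′)) (#-mono translate) ⟩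
  # (P ∩ P′) + # (P ∩ (not ∘ P′))          ≡⟨ #-split P P′ ⟩
  # P                                      ∎
  where
  open ≤-Reasoning
  translate : ∀ z → (P ∩ P′) (z ⊕ x) ≡ true → (P ∩ (not ∘ P′)) z ≡ true
  translate z h with P′ z in p′z
  ... | false = ∧-intro (subst (λ w → P w ≡ true) (⊕-cancelʳ z x) (⊕-closed p (z ⊕ x) x (∧-conicalˡ _ _ h) px)) refl
  ... | true  = ⊥-elim (true≢false
    (subst (λ w → P′ w ≡ true) (⊕-cancelˡ z x) (⊕-closed p′ z (z ⊕ x) p′z (∧-conicalʳ (P (z ⊕ x)) _ h))) p′x)

-- If `y` does not annihilate `P`, translation by some `x₀` in `P` with `dot x₀ y` true exchanges
-- the two halves of `P`. The indicator of `perp P` puts both cases into one equation that can be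
-- summed over `y`.
balance : ∀ {n} {P : F2^ n → Bool} → IsSubspace P → ∀ y →
  2 * # (P ∩ (λ x → dot x y)) + ⟦ perp P y ⟧ * # P ≡ # P
balance {P = P} p y with perp P y in eq
... | true = trans (cong (λ s → 2 * s + 1 * # P) (∑-0 none)) (*-identityˡ (# P))
  where
  none : ∀ x → ⟦ P x ∧ dot x y ⟧ ≡ 0
  none x with P x in px
  ... | true  = cong ⟦_⟧ (perp-elim P x y eq px)
  ... | false = refl
... | false with perp-witness P y eq
... | x₀ , px₀ , d₀ = begin
  2 * # P₁ + 0                                  ≡⟨ double (# P₁) ⟩
  # P₁ + # P₁                                   ≡⟨ cong (# P₁ +_) (∑-shift x₀ _) ⟨
  # P₁ + # (λ x → P₁ (x ⊕ x₀))                  ≡⟨ cong (# P₁ +_) (#-cong translate) ⟩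
  # P₁ + # (P ∩ (λ x → not (dot x y)))          ≡⟨ #-split P (λ x → dot x y) ⟩
  # P                                           ∎
  where
  open ≡-Reasoning
  P₁ = P ∩ (λ x → dot x y)
  double : ∀ a → 2 * a + 0 ≡ a + a
  double = solve-∀
  P-translate : ∀ x → P (x ⊕ x₀) ≡ P x
  P-translate x with P x in px | P (x ⊕ x₀) in px′
  ... | true  | true  = refl
  ... | false | false = refl
  ... | true  | false = ⊥-elim (true≢false (⊕-closed p x x₀ px px₀) px′)
  ... | false | true  = ⊥-elim (true≢false (subst (λ w → P w ≡ true) (⊕-cancelʳ x x₀) (⊕-closed p (x ⊕ x₀) x₀ px′ px₀)) px)
  translate : ∀ x → P₁ (x ⊕ x₀) ≡ (P ∩ (λ x → not (dot x y))) x
  translate x = cong₂ _∧_ (P-translate x)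
    (trans (dot-⊕ˡ x x₀ y) (trans (cong (dot x y xor_) d₀) (xor-comm (dot x y) true)))

-- With `w` an indicator, the first sum counts pairs with product 1. This is the double count behind
-- both `reciprocity` and `average`.
balance-weighted : ∀ {n} (w : F2^ n → ℕ) {P : F2^ n → Bool} → IsSubspace P →
  2 * ∑ (λ y → w y * # (P ∩ (λ x → dot x y))) + ∑ (λ y → w y * ⟦ perp P y ⟧) * # P ≡ ∑ w * # P
balance-weighted {n} w {P} p = begin
  2 * ∑ (λ y → w y * s y) + ∑ (λ y → w y * ⟦ perp P y ⟧) * # P
    ≡⟨ cong₂ _+_ (∑-* {n} 2 _) (∑-*ʳ {n} _ (# P)) ⟨
  ∑ (λ y → 2 * (w y * s y)) + ∑ (λ y → w y * ⟦ perp P y ⟧ * # P)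
    ≡⟨ ∑-+ (λ y → 2 * (w y * s y)) _ ⟨
  ∑ (λ y → 2 * (w y * s y) + w y * ⟦ perp P y ⟧ * # P)
    ≡⟨ ∑-cong (λ y → trans (factor (w y) (s y) ⟦ perp P y ⟧ (# P)) (cong (w y *_) (balance p y))) ⟩
  ∑ (λ y → w y * # P)
    ≡⟨ ∑-*ʳ w (# P) ⟩
  ∑ w * # P ∎
  where
  open ≡-Reasoning
  s = λ y → # (P ∩ (λ x → dot x y))
  factor : ∀ w s q c → 2 * (w * s) + w * q * c ≡ w * (2 * s + q * c)
  factor = solve-∀

∑-dot-swap : ∀ {n} (P P′ : F2^ n → Bool) →
  ∑ (λ x → ⟦ P x ⟧ * # (P′ ∩ (λ y → dot y x))) ≡ ∑ (λ y → ⟦ P′ y ⟧ * # (P ∩ (λ x → dot x y)))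
∑-dot-swap {n} P P′ = begin
  ∑ (λ x → ⟦ P x ⟧ * # (P′ ∩ (λ y → dot y x)))     ≡⟨ ∑-cong (λ x → ∑-* {n} ⟦ P x ⟧ _) ⟨
  ∑ (λ x → ∑ (λ y → ⟦ P x ⟧ * ⟦ P′ y ∧ dot y x ⟧))  ≡⟨ ∑-swap {n} {n} _ ⟩
  ∑ (λ y → ∑ (λ x → ⟦ P x ⟧ * ⟦ P′ y ∧ dot y x ⟧))  ≡⟨ ∑-cong (λ y → trans (∑-cong (λ x → term x y)) (∑-* {n} ⟦ P′ y ⟧ _)) ⟩
  ∑ (λ y → ⟦ P′ y ⟧ * # (P ∩ (λ x → dot x y)))     ∎
  where
  open ≡-Reasoning
  rotate : ∀ a b c → a * (b * c) ≡ b * (a * c)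
  rotate = solve-∀
  term : ∀ x y → ⟦ P x ⟧ * ⟦ P′ y ∧ dot y x ⟧ ≡ ⟦ P′ y ⟧ * ⟦ P x ∧ dot x y ⟧
  term x y rewrite ⟦∧⟧ (P′ y) (dot y x) | ⟦∧⟧ (P x) (dot x y) | dot-comm y x = rotate ⟦ P x ⟧ ⟦ P′ y ⟧ ⟦ dot x y ⟧

-- Both sides count, up to the same constant, the pairs (x , y) ∈ P × P′ with dot x y = 1.
reciprocity : ∀ {n} {P P′ : F2^ n → Bool} → IsSubspace P → IsSubspace P′ →
  # (P ∩ perp P′) * # P′ ≡ # (P′ ∩ perp P) * # P
reciprocity {n} {P} {P′} p p′ = +-cancelˡ-≡ (2 * D) _ _ (begin
  2 * D + # (P ∩ perp P′) * # P′    ≡⟨ cong (λ s → 2 * D + s * # P′) (∑-cong λ y → ⟦∧⟧ (P y) (perp P′ y)) ⟩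
  2 * D + ∑ (λ y → ⟦ P y ⟧ * ⟦ perp P′ y ⟧) * # P′   ≡⟨ balance-weighted (⟦_⟧ ∘ P) p′ ⟩
  # P * # P′                        ≡⟨ *-comm (# P) _ ⟩
  # P′ * # P                        ≡⟨ balance-weighted (⟦_⟧ ∘ P′) p ⟨
  2 * ∑ (λ x → ⟦ P′ x ⟧ * # (P ∩ (λ y → dot y x))) + ∑ (λ x → ⟦ P′ x ⟧ * ⟦ perp P x ⟧) * # P
                                    ≡⟨ cong₂ (λ a b → 2 * a + b * # P) (∑-dot-swap P′ P) (∑-cong λ x → sym (⟦∧⟧ (P′ x) (perp P x))) ⟩
  2 * D + # (P′ ∩ perp P) * # P     ∎)
  where
  open ≡-Reasoning
  D = ∑ (λ y → ⟦ P y ⟧ * # (P′ ∩ (λ x → dot x y)))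

isZero : ∀ {n} → F2^ n → Bool
isZero x = not (nz x)

#-isZero : ∀ n → # (isZero {n}) ≡ 1
#-isZero zero    = refl
#-isZero (suc n) = cong₂ _+_ (#-isZero n) (∑-0 {n} (λ _ → refl))

-- This is `reciprocity` against the whole space, whose annihilator is zero by `nondegenerate`.
perp-size : ∀ {n} {P : F2^ n → Bool} → IsSubspace P → # (perp P) * # P ≡ 2 ^ n
perp-size {n} {P} p = begin
  # (perp P) * # P                               ≡⟨ reciprocity full-isSubspace p ⟩
  # (P ∩ perp (λ _ → true)) * # {n} (λ _ → true) ≡⟨ cong₂ _*_ (trans (#-cong only0) (#-isZero n)) (∑-1 {n}) ⟩
  1 * 2 ^ n                                      ≡⟨ *-identityˡ _ ⟩
  2 ^ n                                          ∎
  where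
  open ≡-Reasoning
  only0 : ∀ x → (P ∩ perp (λ _ → true)) x ≡ isZero x
  only0 x with nz x in eq
  ... | false rewrite nz-false x eq = ∧-intro (0∈ p) (0∈ (perp-isSubspace (λ _ → true)))
  ... | true with (P ∩ perp (λ _ → true)) x in q
  ... | false = refl
  ... | true  = contradiction (trans (sym eq) (trans (cong nz x≡0) (nz-0v n))) λ ()
    where x≡0 = nondegenerate x (λ c → perp-elim (λ _ → true) c x (∧-conicalʳ (P x) _ q) refl)

hyperplane-dichotomy : ∀ {n} {P : F2^ n → Bool} → IsSubspace P → ∀ c →
  (∀ x → P x ≡ true → dot c x ≡ false) ⊎
  ∃ λ x → P x ≡ true × dot c x ≡ true × # ((λ z → not (dot c z)) ∩ P) * 2 ≡ # P
hyperplane-dichotomy {P = P} p c with perp P c in eq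
... | true  = inj₁ (λ x px → trans (dot-comm c x) (perp-elim P x c eq px))
... | false with perp-witness P c eq
... | x , px , d = inj₂ (x , px , trans (dot-comm c x) d , +-cancelˡ-≡ (# P) _ _ (begin
  # P + # (λ z → not (dot c z) ∧ P z) * 2    ≡⟨ cong (λ s → # P + s * 2) (#-cong λ z → trans (∧-comm _ (P z)) (cong (λ d → P z ∧ not d) (dot-comm c z))) ⟩
  # P + N * 2                                ≡⟨ cong (_+ N * 2) balanced ⟨
  2 * Y + N * 2                              ≡⟨ rearrange Y N ⟩
  (Y + N) + (Y + N)                          ≡⟨ cong₂ _+_ (#-split P (λ z → dot z c)) (#-split P (λ z → dot z c)) ⟩
  # P + # P                                  ∎))
  where
  open ≡-Reasoning
  Y = # (P ∩ (λ z → dot z c))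
  N = # (P ∩ (λ z → not (dot z c)))
  balanced : 2 * Y ≡ # P
  balanced = trans (sym (+-identityʳ _)) (trans (cong (λ q → 2 * Y + ⟦ q ⟧ * # P) (sym eq)) (balance p c))
  rearrange : ∀ a b → 2 * a + b * 2 ≡ (a + b) + (a + b)
  rearrange = solve-∀

-- A form vanishing on the kernel so far is dropped; any other halves that kernel and is kept. This
-- reconciles arbitrary families of forms with `HasDisjointCodim`, which demands independence.
independent-subfamily : ∀ {n k} (cs : Vec (F2^ n) k) →
  ∃ λ j → ∃ λ (ds : Vec (F2^ n) j) → j ≤ k × LinIndep ds ×
    (∀ x → ker ds x ≡ ker cs x) × # (ker cs) * 2 ^ j ≡ 2 ^ n
independent-subfamily {n} [] =
  0 , [] , z≤n , (λ { [] a≢0 → ⊥-elim (a≢0 refl) }) , (λ _ → refl) , trans (*-identityʳ _) (∑-1 {n})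
independent-subfamily {n} (c ∷ cs) with independent-subfamily cs
... | j , ds , j≤k , indep , same , sz with hyperplane-dichotomy (ker-isSubspace cs) c
... | inj₁ vanish = j , ds , m≤n⇒m≤1+n j≤k , indep , (λ x → trans (same x) (sym (redundant x))) ,
                    trans (cong (_* 2 ^ j) (#-cong redundant)) sz
  where
  redundant : ∀ x → ker (c ∷ cs) x ≡ ker cs x
  redundant x with ker cs x in q
  ... | true  = ∧-intro (cong not (vanish x q)) refl
  ... | false = ∧-comm (not (dot c x)) false
... | inj₂ (x , px , d , half) =
  suc j , c ∷ ds , s≤s j≤k , indep′ , (λ y → cong (not (dot c y) ∧_) (same y)) ,
  trans (sym (*-assoc (# (ker (c ∷ cs))) 2 (2 ^ j))) (trans (cong (_* 2 ^ j) half) sz)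
  where
  indep′ : LinIndep (c ∷ ds)
  indep′ (false ∷ a) a≢0 = indep a (λ { refl → a≢0 refl })
  -- The point `x` lies in the old kernel and has `dot c x` true, so it detects every combination
  -- that involves `c`.
  indep′ (true ∷ a)  _ z = true≢false d-lin (trans (cong (λ w → dot w x) z) (dot-0ˡ x))
    where
    d-lin : dot (c ⊕ lincomb a ds) x ≡ true
    d-lin = trans (dot-⊕ˡ c _ x) (cong₂ _xor_ d (dot-lincomb a ds x (trans (same x) px)))

-- Inclusion-exclusion and the numerical gap

⟦∨⟧+⟦∧⟧ : ∀ b u v → ⟦ b ∧ (u ∨ v) ⟧ + ⟦ b ∧ (u ∧ v) ⟧ ≡ ⟦ b ∧ u ⟧ + ⟦ b ∧ v ⟧
⟦∨⟧+⟦∧⟧ false u     v     = refl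
⟦∨⟧+⟦∧⟧ true  false v     = +-identityʳ _
⟦∨⟧+⟦∧⟧ true  true  v     = refl

infixr 5 _∪_
_∪_ : ∀ {n} → (F2^ n → Bool) → (F2^ n → Bool) → F2^ n → Bool
(P ∪ P′) x = P x ∨ P′ x

#-∪ : ∀ {n} (B P P′ : F2^ n → Bool) →
  # (B ∩ (P ∪ P′)) + # (B ∩ (P ∩ P′)) ≡ # (B ∩ P) + # (B ∩ P′)
#-∪ B P P′ = trans (sym (∑-+ (λ x → ⟦ (B ∩ (P ∪ P′)) x ⟧) _))
  (trans (∑-cong (λ x → ⟦∨⟧+⟦∧⟧ (B x) (P x) (P′ x))) (∑-+ (λ x → ⟦ (B ∩ P) x ⟧) _))

#-∪-≤ : ∀ {n} (P P′ : F2^ n → Bool) → # (P ∪ P′) ≤ # P + # P′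
#-∪-≤ {n} P P′ = ≤-trans (∑-mono (λ x → pointwise (P x) (P′ x))) (≤-reflexive (∑-+ {n} _ _))
  where
  pointwise : ∀ a b → ⟦ a ∨ b ⟧ ≤ ⟦ a ⟧ + ⟦ b ⟧
  pointwise false b = ≤-refl
  pointwise true  b = s≤s z≤n

-- One half of the bootstrapping in `gap`: a lower bound a/b for y/Q raises f above 16a/b.
step-count : ∀ a b y f Q → a * Q < b * y → 16 * y ≤ f * Q → 16 * a < b * f
step-count a b y f Q p q = *-cancelʳ-< Q (16 * a) (b * f) (begin-strict
  16 * a * Q      ≡⟨ *-assoc 16 a Q ⟩
  16 * (a * Q)    <⟨ *-monoʳ-< 16 p ⟩
  16 * (b * y)    ≡⟨ swap 16 b y ⟩
  b * (16 * y)    ≤⟨ *-monoʳ-≤ b q ⟩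
  b * (f * Q)     ≡⟨ *-assoc b f Q ⟨
  b * f * Q       ∎)
  where
  open ≤-Reasoning
  swap : ∀ a b c → a * (b * c) ≡ b * (a * c)
  swap = solve-∀

-- The other half: the last hypothesis says y/Q > 1 - 2/f, which increases with f and equals j/(2 +
-- j) at f = 2 + j.
step-gap : ∀ j y f Q → 2 + j ≤ f → f * Q < 2 * Q + f * y → j * Q < (2 + j) * y
step-gap j y f Q j≤f p with m≤n⇒∃[o]m+o≡n j≤f
... | g , refl = ≰⇒> λ q → <⇒≱ p (begin
  2 * Q + (2 + j + g) * y            ≡⟨ e₁ Q j g y ⟩
  2 * Q + (2 + j) * y + g * y        ≤⟨ +-mono-≤ (+-monoʳ-≤ (2 * Q) q) (*-monoʳ-≤ g (y≤Q q)) ⟩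
  2 * Q + j * Q + g * Q              ≡⟨ e₂ Q j g ⟩
  (2 + j + g) * Q                    ∎)
  where
  open ≤-Reasoning
  e₁ : ∀ Q j g y → 2 * Q + (2 + j + g) * y ≡ 2 * Q + (2 + j) * y + g * y
  e₁ = solve-∀
  e₂ : ∀ Q j g → 2 * Q + j * Q + g * Q ≡ (2 + j + g) * Q
  e₂ = solve-∀
  y≤Q : (2 + j) * y ≤ j * Q → y ≤ Q
  y≤Q q = *-cancelˡ-≤ (2 + j) (≤-trans q (*-monoˡ-≤ Q (m≤n+m j 2)))

-- The quadratic condition y (Q - y) < Q² / 8 excludes middle values of y / Q.
gap : ∀ y f Q → 16 * y ≤ f * Q → f * Q < 2 * Q + f * y → 6 * y ≤ Q ⊎ 9 * Q < 11 * y
gap y f Q p q with 6 * y ≤? Q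
... | yes small = inj₁ small
... | no  large = inj₂ (step-gap 9 y f Q f≥11 q)
  where
  bound : ∀ a b m → a * Q < b * y → b * m ≤ 16 * a → m < f
  bound a b m h le = ≰⇒> λ f≤m → <⇒≱ (step-count a b y f Q h p) (≤-trans (*-monoʳ-≤ b f≤m) le)
  -- From y/Q > 1/6 follows f ≥ 3, hence y/Q > 1/3 and f ≥ 6, hence y/Q > 2/3 and f ≥ 11, hence y/Q
  -- > 9/11.
  f≥3 : 3 ≤ f
  f≥3 = bound 1 6 2 (subst (_< 6 * y) (sym (*-identityˡ Q)) (≰⇒> large)) (from-yes (6 * 2 ≤? 16 * 1))
  f≥6 : 6 ≤ f
  f≥6 = bound 1 3 5 (step-gap 1 y f Q f≥3 q) (from-yes (3 * 5 ≤? 16 * 1))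
  f≥11 : 11 ≤ f
  f≥11 = bound 4 6 10 (step-gap 4 y f Q f≥6 q) (from-yes (6 * 10 ≤? 16 * 4))

-- Sets of fewer than 3Q points meeting every hyperplane complement

-- Here t = suc s.
module DenseBlocking {r} (B : F2^ r → Bool) (s Q : ℕ) (5≤s : 5 ≤ s) (2^r≡ : 2 ^ r ≡ 2 * 2 ^ s * Q) (#B<3Q : # B < 3 * Q)
  (robust : ∀ φ → nz φ ≡ true → Q ≤ # (B ∩ (λ x → dot x φ)))
  (no-kernel : ∀ k → k ≤ suc s → (cs : Vec (F2^ r) k) → ¬ (∀ x → ker cs x ≡ true → B x ≡ true)) where

  32≤2^s : 32 ≤ 2 ^ s
  32≤2^s = ^-monoʳ-≤ 2 5≤s

  Q≢0 : NonZero Q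
  Q≢0 = m*n≢0⇒n≢0 3 {{>-nonZero (≤-trans (s≤s z≤n) #B<3Q)}}

  -- Sum |{x ∈ B : dot x φ = 1}| over φ ∈ Φ to get S. By `robust`, S ≥ (|Φ| - 1) Q. A point of B is
  -- counted for half of Φ if it lies outside Φ^⊥ and never otherwise, so 2S + |Φ| |B ∩ Φ^⊥| = |Φ|
  -- |B|, and |B| < 3Q gives the bound.
  average : ∀ {Φ A : F2^ r → Bool} → IsSubspace Φ → (∀ x → A x ≡ true → perp Φ x ≡ true) →
    # Φ * # (B ∩ A) < (# Φ + 2) * Q
  average {Φ} {A} sub A⊆ = +-cancelʳ-≤ (2 * S) _ _ (begin
    -- Since 0 ∈ Φ, the 1 of the strict inequality is at most |Φ|, which is absorbed by multiplying
    -- |B| + 1 ≤ 3Q by |Φ|.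
    suc (# Φ * # (B ∩ A)) + 2 * S    ≤⟨ +-monoˡ-≤ (2 * S) (+-mono-≤ (#-witness Φ 0v (0∈ sub)) (*-monoʳ-≤ (# Φ) (#-mono B∩A⊆))) ⟩
    # Φ + # Φ * b + 2 * S            ≡⟨ e₁ (# Φ) b S ⟩
    # Φ + (2 * S + b * # Φ)          ≡⟨ cong (# Φ +_) upper ⟩
    # Φ + # B * # Φ                  ≤⟨ *-monoˡ-≤ (# Φ) #B<3Q ⟩
    3 * Q * # Φ                      ≡⟨ e₂ Q (# Φ) ⟩
    # Φ * Q + 2 * (# Φ * Q)          ≤⟨ +-monoʳ-≤ (# Φ * Q) (*-monoʳ-≤ 2 lower) ⟩
    # Φ * Q + 2 * (S + 1 * Q)        ≡⟨ e₃ (# Φ) Q S ⟩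
    (# Φ + 2) * Q + 2 * S            ∎)
    where
    open ≤-Reasoning
    S = ∑ (λ φ → ⟦ Φ φ ⟧ * # (B ∩ (λ x → dot x φ)))
    b = # (B ∩ perp Φ)
    B∩A⊆ : ∀ x → (B ∩ A) x ≡ true → (B ∩ perp Φ) x ≡ true
    B∩A⊆ x h = ∧-intro (∧-conicalˡ _ _ h) (A⊆ x (∧-conicalʳ (B x) _ h))
    e₁ : ∀ f b s → f + f * b + 2 * s ≡ f + (2 * s + b * f)
    e₁ = solve-∀
    e₂ : ∀ q f → 3 * q * f ≡ f * q + 2 * (f * q)
    e₂ = solve-∀
    e₃ : ∀ f q s → f * q + 2 * (s + 1 * q) ≡ (f + 2) * q + 2 * s
    e₃ = solve-∀
    upper : 2 * S + b * # Φ ≡ # B * # Φ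
    upper = trans (cong₂ (λ s c → 2 * s + c * # Φ) (∑-dot-swap Φ B) (∑-cong (λ y → ⟦∧⟧ (B y) (perp Φ y))))
                  (balance-weighted (λ y → ⟦ B y ⟧) sub)
    -- `robust` says nothing about φ = 0; the `isZero` term makes up for it at the cost of a single
    -- Q.
    pointwise : ∀ φ → ⟦ Φ φ ⟧ * Q ≤ ⟦ Φ φ ⟧ * # (B ∩ (λ x → dot x φ)) + ⟦ isZero φ ⟧ * Q
    pointwise φ with nz φ in eq
    ... | true  = ≤-trans (*-monoʳ-≤ ⟦ Φ φ ⟧ (robust φ eq)) (m≤m+n _ _)
    ... | false = ≤-trans (*-monoˡ-≤ Q (⟦⟧-mono {Φ φ} (λ _ → refl))) (m≤n+m (1 * Q) (⟦ Φ φ ⟧ * # (B ∩ (λ x → dot x φ))))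
    lower : # Φ * Q ≤ S + 1 * Q
    lower = begin
      # Φ * Q                              ≡⟨ ∑-*ʳ {r} _ Q ⟨
      ∑ (λ φ → ⟦ Φ φ ⟧ * Q)                ≤⟨ ∑-mono pointwise ⟩
      ∑ (λ φ → ⟦ Φ φ ⟧ * # (B ∩ (λ x → dot x φ)) + ⟦ isZero φ ⟧ * Q)
                                           ≡⟨ ∑-+ {r} _ _ ⟩
      S + ∑ (λ φ → ⟦ isZero {r} φ ⟧ * Q)   ≡⟨ cong (S +_) (trans (∑-*ʳ {r} _ Q) (cong (_* Q) (#-isZero r))) ⟩
      S + 1 * Q                            ∎


  -- Here |W^⊥| = 2^s ≥ 32, so `average` bounds |B ∩ W| by (1 + 2/32) Q.
  subspace-density : ∀ {W : F2^ r → Bool} → IsSubspace W → # W ≡ 2 * Q → 16 * # (B ∩ W) ≤ 17 * Q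
  subspace-density {W} sub sz = ≮⇒≥ λ big → <⇒≱ (average (perp-isSubspace W) (⊆-perp-perp W)) (begin
    (# (perp W) + 2) * Q     ≡⟨ cong (λ p → (p + 2) * Q) perp≡ ⟩
    (2 ^ s + 2) * Q          ≤⟨ *-cancelˡ-≤ 16 (begin
      16 * ((2 ^ s + 2) * Q)           ≡⟨ e₁ (2 ^ s) Q ⟩
      16 * 2 ^ s * Q + 32 * Q          ≤⟨ +-monoʳ-≤ (16 * 2 ^ s * Q) (*-monoˡ-≤ Q 32≤2^s) ⟩
      16 * 2 ^ s * Q + 2 ^ s * Q       ≡⟨ e₂ (2 ^ s) Q ⟩
      2 ^ s * (17 * Q)                 ≤⟨ *-monoʳ-≤ (2 ^ s) (<⇒≤ big) ⟩
      2 ^ s * (16 * # (B ∩ W))         ≡⟨ e₃ (2 ^ s) (# (B ∩ W)) ⟩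
      16 * (2 ^ s * # (B ∩ W))         ∎) ⟩
    2 ^ s * # (B ∩ W)        ≡⟨ cong (_* # (B ∩ W)) perp≡ ⟨
    # (perp W) * # (B ∩ W)   ∎)
    where
    open ≤-Reasoning
    e₁ : ∀ p q → 16 * ((p + 2) * q) ≡ 16 * p * q + 32 * q
    e₁ = solve-∀
    e₂ : ∀ p q → 16 * p * q + p * q ≡ p * (17 * q)
    e₂ = solve-∀
    e₃ : ∀ p b → p * (16 * b) ≡ 16 * (p * b)
    e₃ = solve-∀
    e₄ : ∀ p q → 2 * p * q ≡ p * (2 * q)
    e₄ = solve-∀
    instance _ = Q≢0
    perp≡ : # (perp W) ≡ 2 ^ s
    perp≡ = *-cancelʳ-≡ (# (perp W)) (2 ^ s) (2 * Q) {{m*n≢0 2 Q}}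
      (trans (cong (# (perp W) *_) (sym sz)) (trans (perp-size sub) (trans 2^r≡ (e₄ (2 ^ s) Q))))

  -- Flats and their pairwise meets

  -- Given by explicit `forms`, possibly dependent, because `no-kernel` speaks of kernels of
  -- families; `codim` only counts the forms.
  record Flat : Set where
    field
      centre   : F2^ r
      codim    : ℕ
      forms    : Vec (F2^ r) codim
    W : F2^ r → Bool
    W = ker forms
    field
      centre∈  : W centre ≡ true
      blocked  : ∀ x → W x ≡ true → B x ∨ B (x ⊕ centre) ≡ true
      #W       : # W ≡ 2 * Q
    W-sub : IsSubspace W
    W-sub = ker-isSubspace forms
  open Flat

  -- A point `x` outside B is charged to `x ⊕ e`, which lies in B. Both positions of `e`, inside and
  -- outside the kernel, occur in `flat-size`.
  translate-cover : ∀ {k} (cs : Vec (F2^ r) k) e → (∀ x → ker cs x ≡ true → B x ∨ B (x ⊕ e) ≡ true) →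
    # (ker cs) ≤ # (B ∩ ker cs) + # (B ∩ (λ x → ker cs (x ⊕ e)))
  translate-cover cs e cover = begin
    # (ker cs)
      ≤⟨ ∑-mono pointwise ⟩
    ∑ (λ x → ⟦ (B ∩ ker cs) x ⟧ + ⟦ B (x ⊕ e) ∧ ker cs ((x ⊕ e) ⊕ e) ⟧)
      ≡⟨ ∑-+ {r} _ _ ⟩
    # (B ∩ ker cs) + ∑ (λ x → ⟦ B (x ⊕ e) ∧ ker cs ((x ⊕ e) ⊕ e) ⟧)
      ≡⟨ cong (# (B ∩ ker cs) +_) (∑-shift e (λ x → ⟦ B x ∧ ker cs (x ⊕ e) ⟧)) ⟩
    # (B ∩ ker cs) + # (B ∩ (λ x → ker cs (x ⊕ e)))
      ∎
    where
    open ≤-Reasoning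
    pointwise : ∀ x → ⟦ ker cs x ⟧ ≤ ⟦ (B ∩ ker cs) x ⟧ + ⟦ B (x ⊕ e) ∧ ker cs ((x ⊕ e) ⊕ e) ⟧
    pointwise x rewrite ⊕-cancelʳ x e with ker cs x in w | B x in bx
    ... | false | _     = z≤n
    ... | true  | true  = s≤s z≤n
    ... | true  | false = ≤-reflexive (cong ⟦_⟧ (sym (∧-intro (trans (cong (_∨ B (x ⊕ e)) (sym bx)) (cover x w)) refl)))

  -- W is invariant under translation by its own `centre`, so both terms of `translate-cover` are |B
  -- ∩ W|.
  flat-filled : ∀ F → Q ≤ # (B ∩ W F)
  flat-filled F = *-cancelˡ-≤ 2 (begin
    2 * Q                                              ≡⟨ #W F ⟨
    # (W F)                                            ≤⟨ translate-cover (forms F) (centre F) (blocked F) ⟩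
    # (B ∩ W F) + # (B ∩ (λ x → W F (x ⊕ centre F)))   ≤⟨ +-monoʳ-≤ (# (B ∩ W F)) (#-mono back) ⟩
    # (B ∩ W F) + # (B ∩ W F)                          ≡⟨ cong (# (B ∩ W F) +_) (+-identityʳ _) ⟨
    2 * # (B ∩ W F)                                    ∎)
    where
    open ≤-Reasoning
    back : ∀ x → (B ∩ (λ x → W F (x ⊕ centre F))) x ≡ true → (B ∩ W F) x ≡ true
    back x h = ∧-intro (∧-conicalˡ _ _ h)
      (subst (λ z → W F z ≡ true) (⊕-cancelʳ x (centre F))
        (⊕-closed (W-sub F) _ _ (∧-conicalʳ (B x) _ h) (centre∈ F)))

  common : Flat → Flat → ℕ
  common F G = # (B ∩ (W F ∩ W G))

  -- Put Φ = perp (`W F`) ∩ perp (`W G`) and apply `average` to the union of the two flats. As each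
  -- holds at least Q points of B, inclusion-exclusion gives f (2Q - y) < (f + 2) Q. By
  -- `reciprocity` the meet has 2Qf / 2^s ≤ fQ/16 points. These are the hypotheses of `gap`.
  common-dichotomy : ∀ F G → 6 * common F G ≤ Q ⊎ 9 * Q < 11 * common F G
  common-dichotomy F G = gap y f Q 16y≤fQ fQ<
    where
    open ≤-Reasoning
    instance _ = Q≢0
    Φ = perp (W F) ∩ perp (W G)
    f = # Φ
    y = common F G
    p = # (perp (W F))
    Φ-sub : IsSubspace Φ
    Φ-sub = ∩-isSubspace (perp-isSubspace (W F)) (perp-isSubspace (W G))
    ⊆Φ⊥ : ∀ x → (W F ∪ W G) x ≡ true → perp Φ x ≡ true
    ⊆Φ⊥ x h = perp-intro Φ x λ c c∈ → lemma c (∧-conicalˡ _ _ c∈) (∧-conicalʳ (perp (W F) c) _ c∈)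
      where
      lemma : ∀ c → perp (W F) c ≡ true → perp (W G) c ≡ true → dot c x ≡ false
      lemma c cF cG with W F x in xF
      ... | true  = trans (dot-comm c x) (perp-elim (W F) x c cF xF)
      ... | false = trans (dot-comm c x) (perp-elim (W G) x c cG h)
    -- `W F` enters through its double annihilator, since that is what `reciprocity` for
    -- `perp (W F)` and `W G` produces.
    m = # (W G ∩ perp (perp (W F)))
    y≤m : y ≤ m
    y≤m = #-mono λ x h → let h′ = ∧-conicalʳ (B x) _ h in
      ∧-intro (∧-conicalʳ (W F x) _ h′) (⊆-perp-perp (W F) x (∧-conicalˡ _ _ h′))
    pQ : p * (2 * Q) ≡ 2 * 2 ^ s * Q
    pQ = trans (cong (p *_) (sym (#W F))) (trans (perp-size (W-sub F)) 2^r≡)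
    fm : f * (2 * Q) ≡ m * p
    fm = trans (cong (f *_) (sym (#W G))) (reciprocity (perp-isSubspace (W F)) (W-sub G))
    16y≤fQ : 16 * y ≤ f * Q
    16y≤fQ = *-cancelˡ-≤ (4 * Q) {{m*n≢0 4 Q}} (begin
      4 * Q * (16 * y)           ≡⟨ e₁ Q y ⟩
      2 * 32 * Q * y             ≤⟨ *-mono-≤ (*-monoˡ-≤ Q (*-monoʳ-≤ 2 32≤2^s)) y≤m ⟩
      2 * 2 ^ s * Q * m          ≡⟨ cong (_* m) pQ ⟨
      p * (2 * Q) * m            ≡⟨ e₂ p Q m ⟩
      m * p * (2 * Q)            ≡⟨ cong (_* (2 * Q)) fm ⟨
      f * (2 * Q) * (2 * Q)      ≡⟨ e₃ f Q ⟩
      4 * Q * (f * Q)            ∎)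
      where
      e₁ : ∀ q y → 4 * q * (16 * y) ≡ 2 * 32 * q * y
      e₁ = solve-∀
      e₂ : ∀ p q m → p * (2 * q) * m ≡ m * p * (2 * q)
      e₂ = solve-∀
      e₃ : ∀ f q → f * (2 * q) * (2 * q) ≡ 4 * q * (f * q)
      e₃ = solve-∀
    fQ< : f * Q < 2 * Q + f * y
    fQ< = +-cancelˡ-< (f * Q) _ _ (begin-strict
      f * Q + f * Q                              ≡⟨ e₁ f Q ⟩
      f * (Q + Q)                                ≤⟨ *-monoʳ-≤ f (+-mono-≤ (flat-filled F) (flat-filled G)) ⟩
      f * (# (B ∩ W F) + # (B ∩ W G))            ≡⟨ cong (f *_) (#-∪ B (W F) (W G)) ⟨
      f * (# (B ∩ (W F ∪ W G)) + y)              ≡⟨ *-distribˡ-+ f _ y ⟩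
      f * # (B ∩ (W F ∪ W G)) + f * y            <⟨ +-monoˡ-< (f * y) (average Φ-sub ⊆Φ⊥) ⟩
      (f + 2) * Q + f * y                        ≡⟨ e₂ f Q y ⟩
      f * Q + (2 * Q + f * y)                    ∎)
      where
      e₁ : ∀ f q → f * q + f * q ≡ f * (q + q)
      e₁ = solve-∀
      e₂ : ∀ f q y → (f + 2) * q + f * y ≡ f * q + (2 * q + f * y)
      e₂ = solve-∀

  -- A meet of more than 9Q/11 points has more than Q/2, hence codimension at most t, and
  -- `no-kernel` forbids such a subspace inside B.
  large-meet-not-filled : ∀ F G → 9 * Q < 11 * common F G → ∃ λ x → (W F ∩ W G) x ≡ true × B x ≡ false
  large-meet-not-filled F G big with search ((W F ∩ W G) ∩ (not ∘ B))
  ... | inj₁ (x , h) = x , ∧-conicalˡ _ _ h , not-injective (∧-conicalʳ ((W F ∩ W G) x) _ h)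
  ... | inj₂ none with independent-subfamily (forms F ++ᵥ forms G)
  ... | k , ds , _ , _ , same , sz = ⊥-elim (no-kernel k k≤ ds filled)
    where
    open ≤-Reasoning
    instance _ = Q≢0
    A = ker (forms F ++ᵥ forms G)
    filled : ∀ x → ker ds x ≡ true → B x ≡ true
    filled x h = not-injective (trans (cong (_∧ not (B x)) (sym (trans (sym (ker-++ (forms F) (forms G) x)) (trans (sym (same x)) h)))) (none x))
    y≤A : common F G ≤ # A
    y≤A = #-mono λ x h → trans (ker-++ (forms F) (forms G) x) (∧-conicalʳ (B x) _ h)
    k≤ : k ≤ suc s
    k≤ = ≮⇒≥ λ s<k → <⇒≱ big (begin
      11 * common F G           ≤⟨ *-monoʳ-≤ 11 y≤A ⟩
      11 * # A                  ≤⟨ *-monoˡ-≤ (# A) (from-yes (11 ≤? 9 * 2)) ⟩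
      9 * 2 * # A               ≡⟨ *-assoc 9 2 (# A) ⟩
      9 * (2 * # A)             ≤⟨ *-monoʳ-≤ 9 (*-cancelˡ-≤ (2 ^ suc s) {{m^n≢0 2 (suc s)}} (begin
        2 ^ suc s * (2 * # A)     ≡⟨ e (2 ^ s) (# A) ⟩
        # A * 2 ^ (2 + s)         ≤⟨ *-monoʳ-≤ (# A) (^-monoʳ-≤ 2 s<k) ⟩
        # A * 2 ^ k               ≡⟨ sz ⟩
        2 ^ r                     ≡⟨ 2^r≡ ⟩
        2 ^ suc s * Q             ∎)) ⟩
      9 * Q                     ∎)
      where
      e : ∀ p a → 2 * p * (2 * a) ≡ a * (2 * (2 * p))
      e = solve-∀

  -- The arithmetic of `separates-witness`: α + α′ exceeds 18Q/11, while b + β is at most 17Q/16 +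
  -- Q/2 = 25Q/16, and 25/16 < 18/11.
  two-large-meets : ∀ α α′ b β a → 9 * Q < 11 * α → 9 * Q < 11 * α′ → α + α′ ≤ b + β →
    2 * β ≤ a → 2 * a ≤ 2 * Q → 16 * b ≤ 17 * Q → ⊥
  two-large-meets α α′ b β a hα hα′ incl hβ ha hb = <⇒≱ (*-monoʳ-< 16 (+-mono-< hα hα′)) (begin
    16 * (11 * α + 11 * α′)           ≡⟨ e₁ α α′ ⟩
    176 * (α + α′)                    ≤⟨ *-monoʳ-≤ 176 incl ⟩
    176 * (b + β)                     ≡⟨ e₂ b β ⟩
    11 * (16 * b) + 88 * (2 * β)      ≤⟨ +-mono-≤ (*-monoʳ-≤ 11 hb) (*-monoʳ-≤ 88 (≤-trans hβ (*-cancelˡ-≤ {a} {Q} 2 ha))) ⟩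
    11 * (17 * Q) + 88 * Q            ≡⟨ e₃ Q ⟩
    275 * Q                           ≤⟨ *-monoˡ-≤ Q (from-yes (275 ≤? 288)) ⟩
    288 * Q                           ≡⟨ e₄ Q ⟩
    16 * (9 * Q + 9 * Q)              ∎)
    where
    open ≤-Reasoning
    e₁ : ∀ a b → 16 * (11 * a + 11 * b) ≡ 176 * (a + b)
    e₁ = solve-∀
    e₂ : ∀ b β → 176 * (b + β) ≡ 11 * (16 * b) + 88 * (2 * β)
    e₂ = solve-∀
    e₃ : ∀ q → 11 * (17 * q) + 88 * q ≡ 275 * q
    e₃ = solve-∀
    e₄ : ∀ q → 288 * q ≡ 16 * (9 * q + 9 * q)
    e₄ = solve-∀

  -- Separating points and the dimension of a flat

  -- The conditions concern only the centre of the new flat, so a centre can be chosen before its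
  -- flat is known.
  Separates : Flat → F2^ r → Set
  Separates F x = ∀ G → W F (centre G) ≡ false → B (centre G ⊕ x) ≡ false → 6 * common G F ≤ Q

  -- By `blocked`, `H` cannot contain `x`, so `W H` takes at most half of `W G ∩ W F`, itself at
  -- most half of `W G` because `centre G` is outside `W F`. Were the meet of `H` with `F` large
  -- too, the two meets would overlap in at most Q/2 points and overfill `B ∩ W F` against
  -- `subspace-density`.
  separates-witness : ∀ F G x → W F (centre G) ≡ false → 9 * Q < 11 * common G F →
    (W G ∩ W F) x ≡ true → B x ≡ false → Separates F x
  separates-witness F G x G∉F big x∈ x∉B H _ H+x∉B = [ (λ small → small) , ⊥-elim ∘ impossible ]′ (common-dichotomy H F)
    where
    open ≤-Reasoning
    A = W G ∩ W F
    A-sub : IsSubspace A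
    A-sub = ∩-isSubspace (W-sub G) (W-sub F)
    x∉H : W H x ≡ false
    x∉H = ¬-not λ xH → true≢false (blocked H x xH)
      (cong₂ _∨_ x∉B (trans (cong B (⊕-comm x (centre H))) H+x∉B))
    in-F : ∀ b g f h → b ∧ ((g ∧ f) ∨ (h ∧ f)) ≡ true → b ∧ f ≡ true
    in-F true true  true  h     _ = refl
    in-F true false true  h     _ = refl
    in-F true true  false true  ()
    in-F true true  false false ()
    in-F true false false true  ()
    in-F true false false false ()
    in-AH : ∀ b g f h → b ∧ ((g ∧ f) ∧ (h ∧ f)) ≡ true → (g ∧ f) ∧ h ≡ true
    in-AH true true true true _ = refl
    incl : common G F + common H F ≤ # (B ∩ W F) + # (A ∩ W H)
    incl = begin
      common G F + common H F
        ≡⟨ #-∪ B A (W H ∩ W F) ⟨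
      # (B ∩ (A ∪ (W H ∩ W F))) + # (B ∩ (A ∩ (W H ∩ W F)))
        ≤⟨ +-mono-≤ (#-mono {P = B ∩ (A ∪ (W H ∩ W F))} {B ∩ W F} (λ z → in-F (B z) (W G z) (W F z) (W H z)))
                    (#-mono {P = B ∩ (A ∩ (W H ∩ W F))} {A ∩ W H} (λ z → in-AH (B z) (W G z) (W F z) (W H z))) ⟩
      # (B ∩ W F) + # (A ∩ W H) ∎
    impossible : 9 * Q < 11 * common H F → ⊥
    impossible big′ = two-large-meets (common G F) (common H F) (# (B ∩ W F)) (# (A ∩ W H)) (# A) big big′
      incl (proper-half A-sub (W-sub H) x x∈ x∉H)
      (subst (2 * # A ≤_) (#W G) (proper-half (W-sub G) (W-sub F) (centre G) (centre∈ G) G∉F))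
      (subspace-density (W-sub F) (#W F))

  -- If some flat centred outside `W F` has a large meet with `F`, a point of that meet outside B
  -- separates; otherwise any point does, and 0 is taken. This case distinction ranges over all
  -- flats, hence the double negation.
  separator : ∀ F → ¬ ¬ ∃ (Separates F)
  separator F none = none (0v , λ G G∉F _ → [ (λ small → small) , ⊥-elim ∘ large G G∉F ]′ (common-dichotomy G F))
    where
    large : ∀ G → W F (centre G) ≡ false → 9 * Q < 11 * common G F → ⊥
    large G G∉F big = let x , x∈ , x∉B = large-meet-not-filled G F big in
      none (x , separates-witness F G x G∉F big x∈ x∉B)

  -- The hypothesis for `s` only bounds the number of forms; density forces the exact dimension and
  -- puts `e` inside, as a `Flat` requires.
  flat-size : ∀ {k} (cs : Vec (F2^ r) k) → k ≤ s → ∀ e →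
    (∀ x → ker cs x ≡ true → B x ∨ B (x ⊕ e) ≡ true) → ker cs e ≡ true × # (ker cs) ≡ 2 * Q
  flat-size cs k≤s e cover with independent-subfamily cs
  ... | j , _ , j≤k , _ , _ , sz with ker cs e in e∈
  -- If `e` were outside, the kernel and its translate would be disjoint and form a subspace twice
  -- as large holding at least w points of B. With its annihilator Φ, `average` gives f w < (f + 2)
  -- Q. Then w ≥ 2Q yields f < 2, against 2^r = p w ≤ 2 f w.
  ... | false = ⊥-elim (<⇒≱ (*-monoˡ-< Q (*-monoˡ-< 2 (+-monoˡ-< 2 f<2))) (begin
      4 * 2 * Q                      ≤⟨ *-monoˡ-≤ Q (≤-trans (from-yes (8 ≤? 64)) (*-monoʳ-≤ 2 32≤2^s)) ⟩
      2 * 2 ^ s * Q                  ≡⟨ trans (sym 2^r≡) (sym pw) ⟩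
      p * w                          ≤⟨ *-mono-≤ p≤2f ≤-refl ⟩
      2 * f * w                      ≡⟨ *-assoc 2 f w ⟩
      2 * (f * w)                    ≤⟨ *-monoʳ-≤ 2 (<⇒≤ fw<) ⟩
      2 * ((f + 2) * Q)              ≡⟨ e₀ f Q ⟩
      (f + 2) * 2 * Q                ∎))
    where
    open ≤-Reasoning
    instance _ = Q≢0
    w = # (ker cs)
    p = # (perp (ker cs))
    Φ = perp (ker cs) ∩ (λ c → not (dot e c))
    f = # Φ
    A = λ x → ker cs x ∨ ker cs (x ⊕ e)
    Φ-sub : IsSubspace Φ
    Φ-sub = ∩-isSubspace (perp-isSubspace (ker cs)) (⊥-isSubspace e)
    pw : p * w ≡ 2 ^ r
    pw = perp-size (ker-isSubspace cs)
    e₀ : ∀ f q → 2 * ((f + 2) * q) ≡ (f + 2) * 2 * q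
    e₀ = solve-∀
    p≤2f : p ≤ 2 * f
    p≤2f = +-cancelˡ-≤ (2 * g) _ _ (begin
      2 * g + p                  ≤⟨ +-monoˡ-≤ p (≤-trans (m≤m+n _ _) (≤-reflexive (balance (perp-isSubspace (ker cs)) e))) ⟩
      p + p                      ≡⟨ cong₂ _+_ split split ⟨
      (g + f) + (g + f)          ≡⟨ e₁ g f ⟩
      2 * g + 2 * f              ∎)
      where
      g = # (perp (ker cs) ∩ (λ c → dot c e))
      e₁ : ∀ g f → (g + f) + (g + f) ≡ 2 * g + 2 * f
      e₁ = solve-∀
      split : g + f ≡ p
      split = trans (cong (_+ f) (#-cong λ c → cong (perp (ker cs) c ∧_) (dot-comm c e)))
                    (#-split (perp (ker cs)) (dot e))
    A⊆ : ∀ x → A x ≡ true → perp Φ x ≡ true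
    A⊆ x h = perp-intro Φ x λ c c∈ →
      lemma c (∧-conicalˡ _ _ c∈) (not-injective (∧-conicalʳ (perp (ker cs) c) _ c∈))
      where
      lemma : ∀ c → perp (ker cs) c ≡ true → dot e c ≡ false → dot c x ≡ false
      lemma c c⊥ e⊥ with ker cs x in x∈
      ... | true  = trans (dot-comm c x) (perp-elim (ker cs) x c c⊥ x∈)
      ... | false = trans (dot-comm c x) (trans (sym (xor-identityʳ (dot x c))) (trans (cong (dot x c xor_) (sym e⊥))
                      (trans (sym (dot-⊕ˡ x e c)) (perp-elim (ker cs) (x ⊕ e) c c⊥ h))))
    w≤ : w ≤ # (B ∩ A)
    w≤ = begin
      w                                                   ≤⟨ translate-cover cs e cover ⟩
      # (B ∩ ker cs) + # (B ∩ (λ x → ker cs (x ⊕ e)))     ≡⟨ #-∪ B (ker cs) (λ x → ker cs (x ⊕ e)) ⟨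
      # (B ∩ A) + # (B ∩ (ker cs ∩ (λ x → ker cs (x ⊕ e)))) ≡⟨ cong (# (B ∩ A) +_) (∑-0 disjoint) ⟩
      # (B ∩ A) + 0                                       ≡⟨ +-identityʳ _ ⟩
      # (B ∩ A)                                           ∎
      where
      disjoint : ∀ x → ⟦ B x ∧ (ker cs x ∧ ker cs (x ⊕ e)) ⟧ ≡ 0
      disjoint x with B x | ker cs x in x∈ | ker cs (x ⊕ e) in xe∈
      ... | false | _     | _     = refl
      ... | true  | false | _     = refl
      ... | true  | true  | false = refl
      ... | true  | true  | true  = ⊥-elim (true≢false
              (subst (λ z → ker cs z ≡ true) (⊕-cancelˡ x e) (⊕-closed (ker-isSubspace cs) x (x ⊕ e) x∈ xe∈)) e∈)
    fw< : f * w < (f + 2) * Q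
    fw< = ≤-trans (s≤s (*-monoʳ-≤ f w≤)) (average Φ-sub A⊆)
    2Q≤w : 2 * Q ≤ w
    2Q≤w = *-cancelˡ-≤ (2 ^ s) {{m^n≢0 2 s}} (begin
      2 ^ s * (2 * Q)     ≡⟨ e₁ (2 ^ s) Q ⟩
      2 * 2 ^ s * Q       ≡⟨ trans (sym 2^r≡) (sym sz) ⟩
      w * 2 ^ j           ≤⟨ *-monoʳ-≤ w (^-monoʳ-≤ 2 (≤-trans j≤k k≤s)) ⟩
      w * 2 ^ s           ≡⟨ *-comm w _ ⟩
      2 ^ s * w           ∎)
      where
      e₁ : ∀ p q → p * (2 * q) ≡ 2 * p * q
      e₁ = solve-∀
    f<2 : f < 2
    f<2 = *-cancelʳ-< Q f 2 (+-cancelˡ-< (f * Q) _ _ (begin-strict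
      f * Q + f * Q       ≡⟨ e₁ f Q ⟩
      f * (2 * Q)         ≤⟨ *-monoʳ-≤ f 2Q≤w ⟩
      f * w               <⟨ fw< ⟩
      (f + 2) * Q         ≡⟨ *-distribʳ-+ Q f 2 ⟩
      f * Q + 2 * Q       ∎))
      where
      e₁ : ∀ f q → f * q + f * q ≡ f * (2 * q)
      e₁ = solve-∀
  -- With `e` inside, w ≤ 2 |B ∩ ker|, and `average` gives 2^s < p + 2 where p = 2^j. For j < s this
  -- fails, as p + 2 would be at most 2^(s-1) + 2 ≤ 2^s.
  ... | true = refl , *-cancelʳ-≡ w (2 * Q) (2 ^ s) {{m^n≢0 2 s}} (begin-equality
      w * 2 ^ s        ≡⟨ cong (λ i → w * 2 ^ i) j≡s ⟨
      w * 2 ^ j        ≡⟨ trans sz 2^r≡ ⟩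
      2 * 2 ^ s * Q    ≡⟨ e₀ (2 ^ s) Q ⟩
      2 * Q * 2 ^ s    ∎)
    where
    open ≤-Reasoning
    instance _ = Q≢0
    w = # (ker cs)
    p = # (perp (ker cs))
    e₀ : ∀ p q → 2 * p * q ≡ 2 * q * p
    e₀ = solve-∀
    w≢0 : NonZero w
    w≢0 = >-nonZero (#-witness (ker cs) e e∈)
    p≡ : p ≡ 2 ^ j
    p≡ = *-cancelʳ-≡ p (2 ^ j) w {{w≢0}} (trans (perp-size (ker-isSubspace cs)) (trans (sym sz) (*-comm w _)))
    w≤2b : w ≤ 2 * # (B ∩ ker cs)
    w≤2b = begin
      w                                                 ≤⟨ translate-cover cs e cover ⟩
      # (B ∩ ker cs) + # (B ∩ (λ x → ker cs (x ⊕ e)))   ≤⟨ +-monoʳ-≤ (# (B ∩ ker cs)) (#-mono back) ⟩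
      # (B ∩ ker cs) + # (B ∩ ker cs)                   ≡⟨ cong (# (B ∩ ker cs) +_) (+-identityʳ _) ⟨
      2 * # (B ∩ ker cs)                                ∎
      where
      back : ∀ x → (B ∩ (λ x → ker cs (x ⊕ e))) x ≡ true → (B ∩ ker cs) x ≡ true
      back x h = ∧-intro (∧-conicalˡ _ _ h)
        (subst (λ z → ker cs z ≡ true) (⊕-cancelʳ x e) (⊕-closed (ker-isSubspace cs) _ _ (∧-conicalʳ (B x) _ h) e∈))
    2^s<p+2 : 2 ^ s < p + 2
    2^s<p+2 = *-cancelʳ-< (2 * Q) _ _ (begin-strict
      2 ^ s * (2 * Q)             ≡⟨ e₁ (2 ^ s) Q ⟩
      2 * 2 ^ s * Q               ≡⟨ trans (sym 2^r≡) (sym (perp-size (ker-isSubspace cs))) ⟩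
      p * w                       ≤⟨ *-monoʳ-≤ p w≤2b ⟩
      p * (2 * # (B ∩ ker cs))    ≡⟨ e₂ p (# (B ∩ ker cs)) ⟩
      2 * (p * # (B ∩ ker cs))    <⟨ *-monoʳ-< 2 (average (perp-isSubspace (ker cs)) (⊆-perp-perp (ker cs))) ⟩
      2 * ((p + 2) * Q)           ≡⟨ e₂ (p + 2) Q ⟨
      (p + 2) * (2 * Q)           ∎)
      where
      e₁ : ∀ p q → p * (2 * q) ≡ 2 * p * q
      e₁ = solve-∀
      e₂ : ∀ p b → p * (2 * b) ≡ 2 * (p * b)
      e₂ = solve-∀
    j≡s : j ≡ s
    j≡s = ≤-antisym (≤-trans j≤k k≤s) (≮⇒≥ λ j<s → <⇒≱ 2^s<p+2 (+-cancelʳ-≤ (2 ^ s) _ _ (begin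
      p + 2 + 2 ^ s               ≡⟨ cong (λ q → q + 2 + 2 ^ s) p≡ ⟩
      2 ^ j + 2 + 2 ^ s           ≤⟨ +-monoˡ-≤ (2 ^ s) (*-cancelˡ-≤ 2 (begin
        2 * (2 ^ j + 2)             ≡⟨ *-distribˡ-+ 2 (2 ^ j) 2 ⟩
        2 ^ suc j + 4               ≤⟨ +-mono-≤ (^-monoʳ-≤ 2 j<s) (≤-trans (from-yes (4 ≤? 32)) 32≤2^s) ⟩
        2 ^ s + 2 ^ s               ≡⟨ cong (2 ^ s +_) (+-identityʳ _) ⟨
        2 * 2 ^ s                   ∎)) ⟩
      2 ^ s + 2 ^ s               ∎)))

  -- Four almost disjoint flats

  module _ (coverable : ∀ e → B e ≡ false → ¬ ¬ (∃ λ k → k ≤ s × ∃ λ (cs : Vec (F2^ r) k) →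
                          ∀ x → ker cs x ≡ true → B x ∨ B (x ⊕ e) ≡ true)) where

    Obstacle : Set
    Obstacle = Σ Flat (∃ ∘ Separates)

    AlmostDisjoint : Obstacle → Obstacle → Set
    AlmostDisjoint (F , _) (G , _) = 6 * common F G ≤ Q

    -- `B` is excluded because `coverable` supplies flats only at centres outside it; the other sets
    -- come from `Separates`. An obstacle costs at most 2Q + 3Q points.
    forbidden : List Obstacle → F2^ r → Bool
    forbidden []                 = B
    forbidden ((F , x , _) ∷ os) = (W F ∪ (λ e → B (e ⊕ x))) ∪ forbidden os

    #-forbidden : ∀ os → # (forbidden os) ≤ length os * (5 * Q) + 3 * Q
    #-forbidden []                 = <⇒≤ #B<3Q
    #-forbidden ((F , x , _) ∷ os) = begin
      # ((W F ∪ (λ e → B (e ⊕ x))) ∪ forbidden os)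
        ≤⟨ #-∪-≤ (W F ∪ (λ e → B (e ⊕ x))) (forbidden os) ⟩
      # (W F ∪ (λ e → B (e ⊕ x))) + # (forbidden os)
        ≤⟨ +-mono-≤ (#-∪-≤ (W F) (λ e → B (e ⊕ x))) (#-forbidden os) ⟩
      (# (W F) + # (λ e → B (e ⊕ x))) + (length os * (5 * Q) + 3 * Q)
        ≤⟨ +-monoˡ-≤ _ (+-mono-≤ (≤-reflexive (#W F)) (≤-trans (≤-reflexive (∑-shift x _)) (<⇒≤ #B<3Q))) ⟩
      (2 * Q + 3 * Q) + (length os * (5 * Q) + 3 * Q)
        ≡⟨ e (length os) Q ⟩
      suc (length os) * (5 * Q) + 3 * Q ∎
      where
      open ≤-Reasoning
      e : ∀ l q → (2 * q + 3 * q) + (l * (5 * q) + 3 * q) ≡ (1 + l) * (5 * q) + 3 * q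
      e = solve-∀

    -- Three obstacles and B exclude at most 3 · 5Q + 3Q = 18Q of the 2^r ≥ 64Q vectors.
    allowed-centre : ∀ os → length os ≤ 3 → ∃ λ e → forbidden os e ≡ false
    allowed-centre os l≤3 = #<⇒avoid (forbidden os) (begin-strict
      # (forbidden os)                ≤⟨ #-forbidden os ⟩
      length os * (5 * Q) + 3 * Q     ≤⟨ +-monoˡ-≤ (3 * Q) (*-monoˡ-≤ (5 * Q) l≤3) ⟩
      3 * (5 * Q) + 3 * Q             ≡⟨ e Q ⟩
      18 * Q                          <⟨ *-monoˡ-< Q (from-yes (18 <? 64)) ⟩
      64 * Q                          ≤⟨ *-monoˡ-≤ Q (*-monoʳ-≤ 2 32≤2^s) ⟩
      2 * 2 ^ s * Q                   ≡⟨ 2^r≡ ⟨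
      2 ^ r                           ∎)
      where
      open ≤-Reasoning
      instance _ = Q≢0
      e : ∀ q → 3 * (5 * q) + 3 * q ≡ 18 * q
      e = solve-∀

    allowed∉B : ∀ os e → forbidden os e ≡ false → B e ≡ false
    allowed∉B []                 e h = h
    allowed∉B ((F , x , _) ∷ os) e h = allowed∉B os e (∨-conicalʳ (W F e ∨ B (e ⊕ x)) _ h)

    allowed-almostDisjoint : ∀ os (o : Obstacle) → forbidden os (centre (proj₁ o)) ≡ false → All (AlmostDisjoint o) os
    allowed-almostDisjoint []                   o h = []
    allowed-almostDisjoint ((F , x , sep) ∷ os) o h =
      sep (proj₁ o) (∨-conicalˡ _ _ h′) (∨-conicalʳ (W F (centre (proj₁ o))) _ h′)
      ∷ allowed-almostDisjoint os o (∨-conicalʳ (W F (centre (proj₁ o)) ∨ B (centre (proj₁ o) ⊕ x)) _ h)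
      where h′ = ∨-conicalˡ (W F (centre (proj₁ o)) ∨ B (centre (proj₁ o) ⊕ x)) _ h

    flat-at : ∀ e → B e ≡ false → ¬ ¬ ∃ λ F → centre F ≡ e
    flat-at e e∉B k = coverable e e∉B λ (_ , k≤s , cs , cover) → k (record
      { centre = e ; forms = cs ; centre∈ = proj₁ (flat-size cs k≤s e cover)
      ; blocked = cover ; #W = proj₂ (flat-size cs k≤s e cover) } , refl)

    -- Greedy choice: each new centre avoids what the earlier obstacles exclude, so `Separates`
    -- makes its flat almost disjoint from all earlier ones. The limit 4 matches the three obstacles
    -- of `allowed-centre`.
    almostDisjoint-family : ∀ m → m ≤ 4 → ¬ ¬ ∃ λ os → length os ≡ m × AllPairs AlmostDisjoint os
    almostDisjoint-family zero    _   k = k ([] , refl , [])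
    almostDisjoint-family (suc m) m<4 k =
      almostDisjoint-family m (<⇒≤ m<4) λ (os , len , pairs) →
      let e , ok = allowed-centre os (subst (_≤ 3) (sym len) (≤-pred m<4)) in
      flat-at e (allowed∉B os e ok) λ (F , centre≡e) →
      separator F λ sep →
      k ((F , sep) ∷ os , cong suc len ,
         allowed-almostDisjoint os (F , sep) (subst (λ e → forbidden os e ≡ false) (sym centre≡e) ok) ∷ pairs)

    union : List Obstacle → F2^ r → Bool
    union []             x = false
    union ((F , _) ∷ os) x = W F x ∨ union os x

    -- The number n(n - 1)/2 of pairs among n flats; its value at 4 is 6.
    triangular : ℕ → ℕ
    triangular zero    = 0
    triangular (suc n) = n + triangular n

    meet-union : ∀ o os → All (AlmostDisjoint o) os → 6 * # (B ∩ (W (proj₁ o) ∩ union os)) ≤ length os * Q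
    meet-union o [] [] = ≤-reflexive (cong (6 *_) (∑-0 (λ x → cong ⟦_⟧ (trans (cong (B x ∧_) (∧-zeroʳ _)) (∧-zeroʳ (B x))))))
    meet-union o@(F , _) ((G , _) ∷ os) (small ∷ smalls) = begin
      6 * # (B ∩ (W F ∩ (W G ∪ union os)))
        ≤⟨ *-monoʳ-≤ 6 (∑-mono (λ x → pointwise (B x) (W F x) (W G x) (union os x))) ⟩
      6 * ∑ (λ x → ⟦ (B ∩ (W F ∩ W G)) x ⟧ + ⟦ (B ∩ (W F ∩ union os)) x ⟧)
        ≡⟨ cong (6 *_) (∑-+ {r} _ _) ⟩
      6 * (common F G + # (B ∩ (W F ∩ union os)))
        ≡⟨ *-distribˡ-+ 6 (common F G) _ ⟩
      6 * common F G + 6 * # (B ∩ (W F ∩ union os))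
        ≤⟨ +-mono-≤ small (meet-union o os smalls) ⟩
      Q + length os * Q ∎
      where
      open ≤-Reasoning
      pointwise : ∀ b f g u → ⟦ b ∧ (f ∧ (g ∨ u)) ⟧ ≤ ⟦ b ∧ (f ∧ g) ⟧ + ⟦ b ∧ (f ∧ u) ⟧
      pointwise false f     g     u = z≤n
      pointwise true  false g     u = z≤n
      pointwise true  true  false u = ≤-refl
      pointwise true  true  true  u = s≤s z≤n

    -- The sum of all |B ∩ W| minus the sum over pairs bounds the union from below; a flat
    -- contributes at least Q and a pair at most Q/6. The factor 6 clears the fraction.
    bonferroni : ∀ os → AllPairs AlmostDisjoint os →
      6 * (length os * Q) ≤ 6 * # (B ∩ union os) + triangular (length os) * Q
    bonferroni []                 []               = z≤n
    bonferroni (o@(F , _) ∷ os) (smalls ∷ pairs) = begin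
      6 * (Q + length os * Q)
        ≡⟨ *-distribˡ-+ 6 Q _ ⟩
      6 * Q + 6 * (length os * Q)
        ≤⟨ +-mono-≤ (*-monoʳ-≤ 6 (flat-filled F)) (bonferroni os pairs) ⟩
      6 * # (B ∩ W F) + (6 * # (B ∩ union os) + t * Q)
        ≡⟨ e₁ (# (B ∩ W F)) (# (B ∩ union os)) (t * Q) ⟩
      6 * (# (B ∩ W F) + # (B ∩ union os)) + t * Q
        ≡⟨ cong (λ n → 6 * n + t * Q) (#-∪ B (W F) (union os)) ⟨
      6 * (# (B ∩ (W F ∪ union os)) + # (B ∩ (W F ∩ union os))) + t * Q
        ≡⟨ e₂ (# (B ∩ (W F ∪ union os))) (# (B ∩ (W F ∩ union os))) (t * Q) ⟩
      6 * # (B ∩ (W F ∪ union os)) + (6 * # (B ∩ (W F ∩ union os)) + t * Q)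
        ≤⟨ +-monoʳ-≤ (6 * # (B ∩ (W F ∪ union os))) (+-monoˡ-≤ (t * Q) (meet-union o os smalls)) ⟩
      6 * # (B ∩ (W F ∪ union os)) + (length os * Q + t * Q)
        ≡⟨ cong (6 * # (B ∩ (W F ∪ union os)) +_) (*-distribʳ-+ Q (length os) t) ⟨
      6 * # (B ∩ (W F ∪ union os)) + (length os + t) * Q ∎
      where
      open ≤-Reasoning
      t = triangular (length os)
      e₁ : ∀ a b c → 6 * a + (6 * b + c) ≡ 6 * (a + b) + c
      e₁ = solve-∀
      e₂ : ∀ a b c → 6 * (a + b) + c ≡ 6 * a + (6 * b + c)
      e₂ = solve-∀

    impossible-density : ⊥
    -- For four flats the inequality reads 24Q ≤ 6|B| + 6Q. The goal is absurd, so the doubly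
    -- negated family can be used directly.
    impossible-density = almostDisjoint-family 4 ≤-refl λ (os , len , pairs) →
      <⇒≱ #B<3Q (*-cancelˡ-≤ {3 * Q} {# B} 6 (+-cancelʳ-≤ (6 * Q) _ _ (begin
        6 * (3 * Q) + 6 * Q                                 ≡⟨ e Q ⟩
        6 * (4 * Q)                                         ≡⟨ cong (λ l → 6 * (l * Q)) len ⟨
        6 * (length os * Q)                                 ≤⟨ bonferroni os pairs ⟩
        6 * # (B ∩ union os) + triangular (length os) * Q   ≡⟨ cong (λ l → 6 * # (B ∩ union os) + triangular l * Q) len ⟩
        6 * # (B ∩ union os) + 6 * Q                        ≤⟨ +-monoˡ-≤ (6 * Q) (*-monoʳ-≤ 6 (#-mono (λ x → ∧-conicalˡ (B x) _))) ⟩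
        6 * # B + 6 * Q                                     ∎)))
      where
      open ≤-Reasoning
      e : ∀ q → 6 * (3 * q) + 6 * q ≡ 6 * (4 * q)
      e = solve-∀

-- Projective geometries and dense matroids

-- No decision procedure for `P` is given. If there were no least witness, well-founded induction
-- would refute `P` everywhere.
¬¬-least : (P : ℕ → Set) → ∀ k → P k → ¬ ¬ ∃ λ j → P j × (∀ i → i < j → ¬ P i)
¬¬-least P k pk none = <-rec (¬_ ∘ P) (λ j below pj → none (j , pj , λ i i<j → below i<j)) k pk

Additive : ∀ {m n} → (F2^ m → F2^ n) → Set
Additive f = ∀ x y → f (x ⊕ y) ≡ f x ⊕ f y

additive-0 : ∀ {m n} {f : F2^ m → F2^ n} → Additive f → f 0v ≡ 0v
additive-0 {f = f} add = begin
  f 0v                   ≡⟨ ⊕-cancelʳ (f 0v) (f 0v) ⟨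
  (f 0v ⊕ f 0v) ⊕ f 0v   ≡⟨ cong (_⊕ f 0v) (add 0v 0v) ⟨
  f (0v ⊕ 0v) ⊕ f 0v     ≡⟨ cong (λ z → f z ⊕ f 0v) (⊕-self 0v) ⟩
  f 0v ⊕ f 0v            ≡⟨ ⊕-self (f 0v) ⟩
  0v                     ∎
  where open ≡-Reasoning

scale : ∀ {n} → Bool → F2^ n → F2^ n
scale b v = if b then v else 0v

scale-xor : ∀ {n} a b (v : F2^ n) → scale (a xor b) v ≡ scale a v ⊕ scale b v
scale-xor false b     v = sym (⊕-identityˡ _)
scale-xor true  false v = sym (⊕-0v v)
scale-xor true  true  v = sym (⊕-self v)

dot-scale : ∀ {n} b (v w : F2^ n) → dot v w ≡ true → dot (scale b v) w ≡ b
dot-scale false v w d = dot-0ˡ w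
dot-scale true  v w d = d

-- Injectivity is automatic: nonzero vectors go to edges, and 0 is not an edge.
contains-PG : ∀ M {k} (f : F2^ k → F2^ (rank M)) → Additive f →
  (∀ y → nz y ≡ true → E M (f y) ≡ true) → Contains M (PGr k)
contains-PG M f add edges = f , add , injective , edges
  where
  injective : ∀ x y → f x ≡ f y → x ≡ y
  injective x y eq = begin
    x             ≡⟨ ⊕-cancelʳ x y ⟨
    (x ⊕ y) ⊕ y   ≡⟨ cong (_⊕ y) (nz-false (x ⊕ y) (¬-not λ n → true≢false (edges (x ⊕ y) n) (trans (cong (E M) f≡0) (simple M)))) ⟩
    0v ⊕ y        ≡⟨ ⊕-identityˡ y ⟩
    y             ∎
    where
    open ≡-Reasoning
    f≡0 : f (x ⊕ y) ≡ 0v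
    f≡0 = trans (add x y) (trans (cong (_⊕ f y) eq) (⊕-self (f y)))

-- The new first coordinate is the coefficient of `v`. Every use of the freeness of M below goes
-- through this extension.
contains-PG-suc : ∀ M {k} (f : F2^ k → F2^ (rank M)) v → Additive f →
  (∀ y → nz y ≡ true → E M (f y) ≡ true) → (∀ y → E M (v ⊕ f y) ≡ true) → Contains M (PGr (suc k))
contains-PG-suc M {k} f v add edges coset = contains-PG M g g-additive g-edges
  where
  g : F2^ (suc k) → F2^ (rank M)
  g (b ∷ y) = scale b v ⊕ f y
  g-additive : Additive g
  g-additive (a ∷ x) (b ∷ y) = trans (cong₂ _⊕_ (scale-xor a b v) (add x y)) (⊕-interchange (scale a v) (scale b v) (f x) (f y))
  g-edges : ∀ y → nz y ≡ true → E M (g y) ≡ true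
  g-edges (false ∷ y) n = trans (cong (E M) (⊕-identityˡ (f y))) (edges y n)
  g-edges (true ∷ y)  n = coset y

-- With p = 2 ^ t and R = 2 ^ r this turns |E| > (1 - 3 / 2 ^ t) 2 ^ r into |B| < 3 * 2 ^ (r - t).
complement-< : ∀ p R e b → 3 ≤ p → e + b ≡ R → (p ∸ 3) * R < p * e → p * b < 3 * R
complement-< p R e b 3≤p refl h with m≤n⇒∃[o]m+o≡n 3≤p
... | q , refl = +-cancelʳ-< (q * (e + b)) _ _ (begin-strict
  (3 + q) * b + q * (e + b)     <⟨ +-monoʳ-< ((3 + q) * b) h ⟩
  (3 + q) * b + (3 + q) * e     ≡⟨ e₁ q e b ⟩
  3 * (e + b) + q * (e + b)     ∎)
  where
  open ≤-Reasoning
  e₁ : ∀ q e b → (3 + q) * b + (3 + q) * e ≡ 3 * (e + b) + q * (e + b)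
  e₁ = solve-∀

complement-> : ∀ p R e b → 3 ≤ p → e + b ≡ R → p * b < 3 * R → (p ∸ 3) * R < p * e
complement-> p R e b 3≤p refl h with m≤n⇒∃[o]m+o≡n 3≤p
... | q , refl = +-cancelˡ-< (3 * (e + b)) _ _ (begin-strict
  3 * (e + b) + q * (e + b)     ≡⟨ e₁ q e b ⟩
  (3 + q) * b + (3 + q) * e     <⟨ +-monoˡ-< ((3 + q) * e) h ⟩
  3 * (e + b) + (3 + q) * e     ∎)
  where
  open ≤-Reasoning
  e₁ : ∀ q e b → 3 * (e + b) + q * (e + b) ≡ (3 + q) * b + (3 + q) * e
  e₁ = solve-∀

3≤2^ : ∀ {k} → 2 ≤ k → 3 ≤ 2 ^ k
3≤2^ 2≤k = ≤-trans (from-yes (3 ≤? 4)) (^-monoʳ-≤ 2 2≤k)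

-- Together, P and its translate by `v` miss fewer than 2^n vectors, so some `x` and `x ⊕ v` both
-- lie in P, and they sum to `v`.
dense-spans : ∀ {n} (P : F2^ n → Bool) → 2 * # (not ∘ P) < 2 ^ n → ∀ v →
  ∃ λ xs → All (λ e → P e ≡ true) xs × sumV xs ≡ v
dense-spans P small v with #<⇒avoid ((not ∘ P) ∪ (λ x → not (P (x ⊕ v)))) (begin-strict
    # ((not ∘ P) ∪ (λ x → not (P (x ⊕ v))))          ≤⟨ #-∪-≤ (not ∘ P) (λ x → not (P (x ⊕ v))) ⟩
    # (not ∘ P) + # (λ x → not (P (x ⊕ v)))          ≡⟨ cong (# (not ∘ P) +_) (trans (∑-shift v _) (sym (+-identityʳ _))) ⟩
    2 * # (not ∘ P)                                  <⟨ small ⟩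
    _                                                ∎)
  where open ≤-Reasoning
... | x , h = x ∷ (x ⊕ v) ∷ [] ,
              not-injective (∨-conicalˡ _ _ h) ∷ not-injective (∨-conicalʳ (not (P x)) _ h) ∷ [] ,
              trans (cong (x ⊕_) (⊕-0v (x ⊕ v))) (⊕-cancelˡ x v)

disjoint-codim : ∀ M {k} (cs : Vec (F2^ (rank M)) k) → (∀ x → ker cs x ≡ true → E M x ≡ false) →
  ∃ λ j → j ≤ k × HasDisjointCodim M j
disjoint-codim M cs disj with independent-subfamily cs
... | j , ds , j≤k , indep , same , _ =
  j , j≤k , ds , indep , λ x x∈ → disj x (trans (sym (same x)) (InKernel⇒ker ds x x∈))

disjoint-codim-rank : ∀ M → ∃ λ j → j ≤ rank M × HasDisjointCodim M j
disjoint-codim-rank M = disjoint-codim M (basis (rank M)) λ x h → trans (cong (E M) (ker-basis x h)) (simple M)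

-- The hypothesis of the theorem for t = s + 1: `PGr s` is PG(t-2,2), and the two values are t - 2
-- and t - 1.
DenseCriticalBound : ℕ → Set
DenseCriticalBound s = ∀ (M′ : Matroid) → Free (PGr s) M′ →
  (2 ^ s ∸ 3) * 2 ^ rank M′ < 2 ^ s * size M′ → ∀ k → CriticalNumber M′ k → k ≡ s ∸ 1 ⊎ k ≡ s

-- The hypothesis restated for sets: density makes P span, so P is the edge set of a matroid on the
-- whole space, and the forms realising its critical number are returned. The double negation comes
-- from `¬¬-least`.
small-kernel : ∀ {r} s → 5 ≤ s → DenseCriticalBound s → (P : F2^ r → Bool) → P 0v ≡ false →
  2 ^ s * # (not ∘ P) < 3 * 2 ^ r →
  (∀ (f : F2^ s → F2^ r) → Additive f → ¬ (∀ y → nz y ≡ true → P (f y) ≡ true)) →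
  ¬ ¬ ∃ λ k → k ≤ s × ∃ λ (cs : Vec (F2^ r) k) → ∀ x → ker cs x ≡ true → P x ≡ false
small-kernel {r} s 5≤s hyp P P0 small free none =
  ¬¬-least (HasDisjointCodim M′) j₀ has₀ λ (k , has@(cs , _ , disj) , least) →
    none (k , bound (hyp M′ (λ (f , add , _ , edges) → free f add edges)
                dense k (has , least)) , cs , λ x h → disj x (ker⇒InKernel cs x h))
  where
  open ≤-Reasoning
  2∁<2^r : 2 * # (not ∘ P) < 2 ^ r
  2∁<2^r = ≰⇒> λ h → <⇒≱ small (begin
    3 * 2 ^ r                    ≤⟨ *-monoˡ-≤ (2 ^ r) (from-yes (3 ≤? 16)) ⟩
    16 * 2 ^ r                   ≤⟨ *-monoʳ-≤ 16 h ⟩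
    16 * (2 * # (not ∘ P))       ≡⟨ *-assoc 16 2 (# (not ∘ P)) ⟨
    32 * # (not ∘ P)             ≤⟨ *-monoˡ-≤ (# (not ∘ P)) (^-monoʳ-≤ 2 5≤s) ⟩
    2 ^ s * # (not ∘ P)          ∎)
  M′ : Matroid
  M′ = record { rank = r ; E = P ; simple = P0 ; spans = dense-spans P 2∁<2^r }
  dense : (2 ^ s ∸ 3) * 2 ^ r < 2 ^ s * size M′
  dense = complement-> (2 ^ s) (2 ^ r) (size M′) (# (not ∘ P)) (3≤2^ (≤-trans (from-yes (2 ≤? 5)) 5≤s))
    (trans (cong (_+ # (not ∘ P)) (length-filter-allVecs r P)) (#-complement P)) small
  bound : ∀ {k} → k ≡ s ∸ 1 ⊎ k ≡ s → k ≤ s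
  bound (inj₁ refl) = m∸n≤m s 1
  bound (inj₂ refl) = ≤-refl
  j₀ = proj₁ (disjoint-codim-rank M′)
  has₀ = proj₂ (proj₂ (disjoint-codim-rank M′))

-- A free matroid of critical number above t

module _ (s : ℕ) (5≤s : 5 ≤ s) (hyp : DenseCriticalBound s) (M : Matroid) (free : Free (PGr (suc s)) M)
  (large : ∀ k → CriticalNumber M k → suc s < k) where

  private
    r = rank M
    B : F2^ r → Bool
    B = not ∘ E M

  no-disjoint-codim : ∀ k → k ≤ suc s → ¬ HasDisjointCodim M k
  no-disjoint-codim k k≤t has = ¬¬-least (HasDisjointCodim M) k has λ (j , crit) →
    proj₂ crit k (≤-<-trans k≤t (large j crit)) has

  no-kernel-in-complement : ∀ {k} → k ≤ suc s → (cs : Vec (F2^ r) k) → ¬ (∀ x → ker cs x ≡ true → B x ≡ true)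
  no-kernel-in-complement k≤t cs filled with disjoint-codim M cs (λ x h → not-injective (filled x h))
  ... | j , j≤k , has = no-disjoint-codim j (≤-trans j≤k k≤t) has

  -- The zero subspace avoids the edges, so a smaller rank would contradict `no-disjoint-codim`. The
  -- bound makes Q = 2^(r - t) a natural number.
  large-rank : suc s ≤ r
  large-rank = ≰⇒≥ λ r≤t → let j , j≤r , has = disjoint-codim-rank M in no-disjoint-codim j (≤-trans j≤r r≤t) has

  module _ (Q : ℕ) (2^r≡ : 2 ^ r ≡ 2 * 2 ^ s * Q) (2^tB< : 2 * 2 ^ s * # B < 3 * 2 ^ r) where

    -- Passing from t to t - 1 doubles the complement that the density bound allows. This is the
    -- room for the pairs {x, x + e} and for preimages under a projection.
    twice-thin : (P : F2^ r → Bool) → # P ≤ 2 * # B → 2 ^ s * # P < 3 * 2 ^ r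
    twice-thin P P≤ = begin-strict
      2 ^ s * # P            ≤⟨ *-monoʳ-≤ (2 ^ s) P≤ ⟩
      2 ^ s * (2 * # B)      ≡⟨ e (2 ^ s) (# B) ⟩
      2 * 2 ^ s * # B        <⟨ 2^tB< ⟩
      3 * 2 ^ r              ∎
      where
      open ≤-Reasoning
      e : ∀ p b → p * (2 * b) ≡ 2 * p * b
      e = solve-∀

    two-translates : ∀ v (P : F2^ r → Bool) → (∀ x → P x ≡ true → B x ∨ B (x ⊕ v) ≡ true) → # P ≤ 2 * # B
    two-translates v P P⊆ = begin
      # P                            ≤⟨ #-mono P⊆ ⟩
      # (B ∪ (λ x → B (x ⊕ v)))      ≤⟨ #-∪-≤ B (λ x → B (x ⊕ v)) ⟩
      # B + # (λ x → B (x ⊕ v))      ≡⟨ cong (# B +_) (trans (∑-shift v _) (sym (+-identityʳ _))) ⟩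
      2 * # B                        ∎
      where open ≤-Reasoning

    -- A PG(s-1,2) inside `P` would extend by `e` to a PG(s,2) in M, so `small-kernel` applies to
    -- `P`; on a kernel avoiding `P`, every pair {x, x + e} meets B.
    coverable : ∀ e → B e ≡ false → ¬ ¬ (∃ λ k → k ≤ s × ∃ λ (cs : Vec (F2^ r) k) →
      ∀ x → ker cs x ≡ true → B x ∨ B (x ⊕ e) ≡ true)
    coverable e e∉B none = small-kernel s 5≤s hyp P (cong (_∧ E M (0v ⊕ e)) (simple M))
      (twice-thin (not ∘ P) (two-translates e (not ∘ P) λ x h → trans (sym (deMorgan₁ (E M x) _)) h))
      PG-free λ (k , k≤s , cs , disj) →
        none (k , k≤s , cs , λ x h → trans (sym (deMorgan₁ (E M x) _)) (cong not (disj x h)))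
      where
      P : F2^ r → Bool
      P x = E M x ∧ E M (x ⊕ e)
      PG-free : ∀ (f : F2^ s → F2^ r) → Additive f → ¬ (∀ y → nz y ≡ true → P (f y) ≡ true)
      PG-free f add edges = free (contains-PG-suc M f e add (λ y n → ∧-conicalˡ _ _ (edges y n)) coset)
        where
        coset : ∀ y → E M (e ⊕ f y) ≡ true
        coset y with nz y in n
        ... | true  = trans (cong (E M) (⊕-comm e (f y))) (∧-conicalʳ (E M (f y)) _ (edges y n))
        -- At y = 0 the point of the coset is `e` itself, an edge by assumption.
        ... | false rewrite nz-false y n = trans (cong (E M) (trans (cong (e ⊕_) (additive-0 add)) (⊕-0v e))) (not-injective e∉B)

    -- The map `π` projects along `v` onto φ^⊥. If the preimage `P` of E(M) contains no PG(s-1,2),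
    -- `small-kernel` puts a subspace of too small codimension inside B. If it contains one, `π`
    -- moves it into φ^⊥ and `many` finds the Q points.
    robust : ∀ φ → nz φ ≡ true → Q ≤ # (B ∩ (λ x → dot x φ))
    robust φ φ≢0 with search (λ c → dot c φ)
    ... | inj₂ none = ⊥-elim (true≢false φ≢0 (trans (cong nz (nondegenerate φ none)) (nz-0v r)))
    ... | inj₁ (v , dv) = ≮⇒≥ λ few →
      small-kernel s 5≤s hyp P (trans (cong (E M) (additive-0 π-additive)) (simple M))
        (twice-thin (not ∘ P) (two-translates v (not ∘ P) λ x → B∘π⊆ x (dot x φ)))
        (λ f add edges → <⇒≱ few (many (π ∘ f) (λ x y → trans (cong π (add x y)) (π-additive (f x) (f y)))
                                       edges (λ y → dot-π (f y))))
        -- Adding φ gives at most s + 1 = t forms. On φ^⊥ the map `π` is the identity, so there `P`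
        -- agrees with E(M).
        λ (k , k≤s , cs , disj) → no-kernel-in-complement (s≤s k≤s) (φ ∷ cs) λ x h →
          cong not (trans (cong (E M) (sym (π-fixed x (trans (dot-comm x φ) (not-injective (∧-conicalˡ _ _ h))))))
                          (disj x (∧-conicalʳ (not (dot φ x)) _ h)))
      where
      open ≤-Reasoning
      π : F2^ r → F2^ r
      π x = scale (dot x φ) v ⊕ x
      P : F2^ r → Bool
      P = E M ∘ π
      π-additive : Additive π
      π-additive x y = trans (cong (_⊕ (x ⊕ y)) (trans (cong (λ b → scale b v) (dot-⊕ˡ x y φ)) (scale-xor (dot x φ) (dot y φ) v)))
                             (⊕-interchange (scale (dot x φ) v) (scale (dot y φ) v) x y)
      π-fixed : ∀ x → dot x φ ≡ false → π x ≡ x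
      π-fixed x d = trans (cong (λ b → scale b v ⊕ x) d) (⊕-identityˡ x)
      dot-π : ∀ x → dot (π x) φ ≡ false
      dot-π x = trans (dot-⊕ˡ (scale (dot x φ) v) x φ) (trans (cong (_xor dot x φ) (dot-scale (dot x φ) v φ dv)) (xor-same (dot x φ)))
      B∘π⊆ : ∀ x b → B (scale b v ⊕ x) ≡ true → B x ∨ B (x ⊕ v) ≡ true
      B∘π⊆ x false h = cong (_∨ B (x ⊕ v)) (trans (cong B (sym (⊕-identityˡ x))) h)
      B∘π⊆ x true  h with B x
      ... | true  = refl
      ... | false = trans (cong B (⊕-comm x v)) h
      -- Every coset of the image of `f` off the hyperplane meets B, or else M would contain a
      -- PG(s,2). There are 2^(r-1) choices of `w` off the hyperplane, and each point of `B₁` arises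
      -- from 2^s pairs (w, y), so 2^s N ≥ 2^(r-1).
      many : ∀ (f : F2^ s → F2^ r) → Additive f → (∀ y → nz y ≡ true → E M (f y) ≡ true) →
        (∀ y → dot (f y) φ ≡ false) → Q ≤ # (B ∩ (λ x → dot x φ))
      many f add edges f⊥ = *-cancelˡ-≤ (2 * 2 ^ s) {{m^n≢0 2 (suc s)}} (begin
        2 * 2 ^ s * Q                     ≡⟨ 2^r≡ ⟨
        2 ^ r                             ≡⟨ half ⟨
        2 * # (λ w → dot w φ)             ≤⟨ *-monoʳ-≤ 2 cosets ⟩
        2 * (2 ^ s * N)                   ≡⟨ *-assoc 2 (2 ^ s) N ⟨
        2 * 2 ^ s * N                     ∎)
        where
        B₁ = B ∩ (λ x → dot x φ)
        N = # B₁
        half : 2 * # (λ w → dot w φ) ≡ 2 ^ r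
        half = trans (sym (+-identityʳ _)) (trans (cong (λ b → 2 * # (λ w → dot w φ) + ⟦ b ⟧ * # {r} (λ _ → true)) (sym perp-false))
                 (trans (balance full-isSubspace φ) (∑-1 {r})))
          where
          perp-false : perp (λ _ → true) φ ≡ false
          perp-false = ¬-not λ h → true≢false dv (perp-elim (λ _ → true) v φ h refl)
        meets : ∀ w → dot w φ ≡ true → 1 ≤ ∑ (λ y → ⟦ B₁ (w ⊕ f y) ⟧)
        meets w dw with search (λ y → B (w ⊕ f y))
        ... | inj₁ (y , h) = #-witness (λ y → B₁ (w ⊕ f y)) y
                (∧-intro h (trans (dot-⊕ˡ w (f y) φ) (cong₂ _xor_ dw (f⊥ y))))
        ... | inj₂ none = ⊥-elim (free (contains-PG-suc M f w add edges (λ y → not-injective (none y))))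
        pointwise : ∀ w → ⟦ dot w φ ⟧ ≤ ∑ (λ y → ⟦ B₁ (w ⊕ f y) ⟧)
        pointwise w with dot w φ in dw
        ... | true  = meets w dw
        ... | false = z≤n
        cosets : # (λ w → dot w φ) ≤ 2 ^ s * N
        cosets = begin
          # (λ w → dot w φ)                              ≤⟨ ∑-mono pointwise ⟩
          ∑ (λ w → ∑ (λ y → ⟦ B₁ (w ⊕ f y) ⟧))           ≡⟨ ∑-swap {r} {s} _ ⟩
          ∑ (λ y → ∑ (λ w → ⟦ B₁ (w ⊕ f y) ⟧))           ≡⟨ ∑-cong (λ y → ∑-shift (f y) (λ w → ⟦ B₁ w ⟧)) ⟩
          ∑ {s} (λ _ → N)                                ≡⟨ ∑-const {s} N ⟩
          2 ^ s * N                                      ∎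

    #B<3Q : # B < 3 * Q
    #B<3Q = *-cancelˡ-< (2 * 2 ^ s) _ _ (begin-strict
      2 * 2 ^ s * # B         <⟨ 2^tB< ⟩
      3 * 2 ^ r               ≡⟨ cong (3 *_) 2^r≡ ⟩
      3 * (2 * 2 ^ s * Q)     ≡⟨ e (2 * 2 ^ s) Q ⟩
      2 * 2 ^ s * (3 * Q)     ∎)
      where
      open ≤-Reasoning
      e : ∀ a q → 3 * (a * q) ≡ a * (3 * q)
      e = solve-∀

    contradictory : ⊥
    contradictory = DenseBlocking.impossible-density B s Q 5≤s 2^r≡ #B<3Q robust (λ k → no-kernel-in-complement) coverable

theorem2p10 : (t : ℕ) → 6 ≤ t →
    (∀ (M' : Matroid) → Free (PGr (t ∸ 1)) M' →
    (2 ^ (t ∸ 1) ∸ 3) * 2 ^ rank M' < 2 ^ (t ∸ 1) * size M' →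
    ∀ k → CriticalNumber M' k → k ≡ t ∸ 2 ⊎ k ≡ t ∸ 1) →
    ¬ (∃ λ (M : Matroid) → Free (PGr t) M ×
    (2 ^ t ∸ 3) * 2 ^ rank M < 2 ^ t * size M ×
    (∀ k → CriticalNumber M k → t < k))
theorem2p10 (suc s) (s≤s 5≤s) hyp (M , free , dense , large) with m≤n⇒∃[o]m+o≡n (large-rank s 5≤s hyp M free large)
-- Here n = r - t, so that Q = 2^n.
... | n , t+n≡r = contradictory s 5≤s hyp M free large (2 ^ n)
  (trans (cong (2 ^_) (sym t+n≡r)) (^-distribˡ-+-* 2 (suc s) n))
  (complement-< (2 ^ suc s) (2 ^ rank M) (size M) _ (3≤2^ (≤-trans (from-yes (2 ≤? 6)) (s≤s 5≤s)))
    (trans (cong (_+ # (not ∘ E M)) (length-filter-allVecs (rank M) (E M))) (#-complement (E M))) dense)
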